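{- For every $n\ge 1$ we have the Schur expansions $$\prod_{1\le i<j\le n}(1+x_i+x_j)=\sum_{\mu\subseteq\delta_{n-1}} r^{(n)}_\mu\, s_\mu(x_1,\dots,x_n),$$ $$\prod_{1\le i\le j\le n}(1+x_i+x_j)=\sum_{\lambda\subseteq\delta_n}\ \sum_{\substack{\mu\subseteq \lambda\cap\delta_{n-1}\\ \lambda/\mu \text{ a vertical strip}}} 2^{|\lambda/\mu|}\, r^{(n)}_\mu\, s_\lambda(x_1,\dots,x_n).$$
   Context: Partitions are identified with their Ferrers diagrams (row $i$ has $\lambda_i$ left-justified boxes), and $\mu\subseteq\lambda$ means containment of diagrams. For $m\ge 0$, $\delta_m=(m,m-1,\dots,1)$ is the staircase partition (with $\delta_0=\varnothing$). For a partition $\mu\subseteq\delta_{n-1}$, a reverse flagged filling of shape $\mu$ is a filling of the boxes of $\mu$ with positive integers such that entries strictly decrease from left to right along each row, weakly decrease from top to bottom down each column, and every entry in row $i$ lies in $\{1,2,\dots,n-i\}$. $r^{(n)}_\mu$ denotes the number of reverse flagged fillings of shape $\mu$ (the empty shape has exactly one filling). For $\mu\subseteq\lambda$, $\lambda/\mu$ is the set of boxes of $\lambda$ not in $\mu$, $|\lambda/\mu|$ its number of boxes, and $\lambda/\mu$ is a vertical strip if no row contains more than one of its boxes. $s_\mu(x_1,\dots,x_n)$ denotes the Schur polynomial in $n$ variables (zero if $\mu$ has more than $n$ parts). -}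

module Defs where

open import Data.Bool using (Bool; true; false; _∧_)
open import Data.Nat using (ℕ; zero; suc; _∸_; _≤ᵇ_; _<ᵇ_; _≡ᵇ_)
open import Data.Fin using (Fin; toℕ)
open import Data.List using (List; []; _∷_; map; concatMap; concat; foldr; upTo; allFin; filterᵇ; length)
open import Data.Nat.ListAction using (sum)
open import Data.Product using (_×_; _,_)
open import Algebra.Bundles using (CommutativeRing)

choices : {A : Set} → List (List A) → List (List A)
choices []         = [] ∷ []
choices (xs ∷ xss) = concatMap (λ a → map (a ∷_) (choices xss)) xs

rowsFrom : {A : Set} → List A → ℕ → List (List A)
rowsFrom vs zero    = [] ∷ []
rowsFrom vs (suc ℓ) = concatMap (λ a → map (a ∷_) (rowsFrom vs ℓ)) vs

oneTo : ℕ → List ℕ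
oneTo m = map suc (upTo m)

zeroTo : ℕ → List ℕ
zeroTo m = upTo (suc m)

-- Partitions (as lists of row lengths, trailing zero rows allowed)

weaklyDecr : List ℕ → Bool
weaklyDecr (a ∷ b ∷ xs) = (b ≤ᵇ a) ∧ weaklyDecr (b ∷ xs)
weaklyDecr _            = true

staircaseFrom : ℕ → ℕ → List ℕ
staircaseFrom zero    _ = []
staircaseFrom (suc k) b = b ∷ staircaseFrom k (b ∸ 1)

-- all partitions μ ⊆ δ_m, each written as a weakly decreasing list of
-- length m (μ_1, ..., μ_m) with μ_i ≤ m + 1 - i; each occurs exactly once
subStaircase : ℕ → List (List ℕ)
subStaircase m = filterᵇ weaklyDecr (choices (map zeroTo (staircaseFrom m m)))

containedᵇ : List ℕ → List ℕ → Bool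
containedᵇ []       _        = true
containedᵇ (a ∷ as) []       = (a ≡ᵇ 0) ∧ containedᵇ as []
containedᵇ (a ∷ as) (b ∷ bs) = (a ≤ᵇ b) ∧ containedᵇ as bs

-- for μ ⊆ λ : λ/μ is a vertical strip, i.e. λ_i ≤ μ_i + 1 for all i
-- (rows of μ beyond its length are 0)
verticalStripᵇ : List ℕ → List ℕ → Bool
verticalStripᵇ _        []       = true
verticalStripᵇ []       (b ∷ bs) = (b ≤ᵇ 1) ∧ verticalStripᵇ [] bs
verticalStripᵇ (a ∷ as) (b ∷ bs) = (b ≤ᵇ suc a) ∧ verticalStripᵇ as bs

-- |λ/μ| for μ ⊆ λ
skewSize : List ℕ → List ℕ → ℕ
skewSize λ' μ = sum λ' ∸ sum μ

-- Fillings (a filling = list of rows, row i = entries of row i left to right)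

strictlyDecr : List ℕ → Bool
strictlyDecr (a ∷ b ∷ xs) = (b <ᵇ a) ∧ strictlyDecr (b ∷ xs)
strictlyDecr _            = true

belowLeq : List ℕ → List ℕ → Bool
belowLeq (b ∷ bs) (a ∷ as) = (b ≤ᵇ a) ∧ belowLeq bs as
belowLeq _        _        = true

colsWeaklyDecr : List (List ℕ) → Bool
colsWeaklyDecr (r ∷ r' ∷ rs) = belowLeq r' r ∧ colsWeaklyDecr (r' ∷ rs)
colsWeaklyDecr _             = true

isReverseFlaggedShapeOK : List (List ℕ) → Bool
isReverseFlaggedShapeOK T = foldr (λ r b → strictlyDecr r ∧ b) true T ∧ colsWeaklyDecr T

flaggedCands : ℕ → ℕ → List ℕ → List (List (List ℕ))
flaggedCands n i μ = choices (go i μ)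
  where
  go : ℕ → List ℕ → List (List (List ℕ))
  go i []       = []
  go i (l ∷ ls) = rowsFrom (oneTo (n ∸ i)) l ∷ go (suc i) ls

r : ℕ → List ℕ → ℕ
r n μ = length (filterᵇ isReverseFlaggedShapeOK (flaggedCands n 1 μ))

-- Semistandard Young tableaux with entries in Fin n (standing for 1..n)

weaklyIncr : {n : ℕ} → List (Fin n) → Bool
weaklyIncr (a ∷ b ∷ xs) = (toℕ a ≤ᵇ toℕ b) ∧ weaklyIncr (b ∷ xs)
weaklyIncr _            = true

belowGreater : {n : ℕ} → List (Fin n) → List (Fin n) → Bool
belowGreater (b ∷ bs) (a ∷ as) = (toℕ a <ᵇ toℕ b) ∧ belowGreater bs as
belowGreater _        _        = true

colsStrictlyIncr : {n : ℕ} → List (List (Fin n)) → Bool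
colsStrictlyIncr (r ∷ r' ∷ rs) = belowGreater r' r ∧ colsStrictlyIncr (r' ∷ rs)
colsStrictlyIncr _             = true

isSSYT : {n : ℕ} → List (List (Fin n)) → Bool
isSSYT T = foldr (λ r b → weaklyIncr r ∧ b) true T ∧ colsStrictlyIncr T

ssyt : (n : ℕ) → List ℕ → List (List (List (Fin n)))
ssyt n λ' = filterᵇ isSSYT (choices (map (rowsFrom (allFin n)) λ'))

pairsLt : (n : ℕ) → List (Fin n × Fin n)
pairsLt n = concatMap (λ i → concatMap (λ j → filterᵇ (λ _ → toℕ i <ᵇ toℕ j) ((i , j) ∷ [])) (allFin n)) (allFin n)

pairsLe : (n : ℕ) → List (Fin n × Fin n)
pairsLe n = concatMap (λ i → concatMap (λ j → filterᵇ (λ _ → toℕ i ≤ᵇ toℕ j) ((i , j) ∷ [])) (allFin n)) (allFin n)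

module _ {c ℓ} (R : CommutativeRing c ℓ) where
  open CommutativeRing R

  sumR : List Carrier → Carrier
  sumR = foldr _+_ 0#

  prodR : List Carrier → Carrier
  prodR = foldr _*_ 1#

  natR : ℕ → Carrier
  natR zero    = 0#
  natR (suc k) = 1# + natR k

  schur : {n : ℕ} → (Fin n → Carrier) → List ℕ → Carrier
  schur {n} x λ' = sumR (map (λ T → prodR (map x (concat T))) (ssyt n λ'))

  prodLt : {n : ℕ} → (Fin n → Carrier) → Carrier
  prodLt {n} x = prodR (map (λ { (i , j) → 1# + x i + x j }) (pairsLt n))

  prodLe : {n : ℕ} → (Fin n → Carrier) → Carrier
  prodLe {n} x = prodR (map (λ { (i , j) → 1# + x i + x j }) (pairsLe n))

  rhsLt : {n : ℕ} → (Fin n → Carrier) → Carrier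
  rhsLt {n} x = sumR (map (λ μ → natR (r n μ) * schur x μ) (subStaircase (n ∸ 1)))

  rhsLe : {n : ℕ} → (Fin n → Carrier) → Carrier
  rhsLe {n} x = sumR (map (λ λ' →
      sumR (map (λ μ → natR (2 Data.Nat.^ skewSize λ' μ) * natR (r n μ) * schur x λ')
                (filterᵇ (λ μ → containedᵇ μ λ' ∧ verticalStripᵇ μ λ')
                         (subStaircase (n ∸ 1)))))
    (subStaircase n))

{-# OPTIONS --safe --termination-depth=2 #-}

-- Peel off the last variable t of the product over i < j. The remaining factors 1 + t + xᵢ act on
-- Schur polynomials by the dual Pieri rule (adding vertical strips), while s_μ(x, t) branches into
-- s_θ(x) by removing horizontal strips. The first expansion therefore reduces to an identity
-- between coefficients: removing horizontal strips of weight t from Σ r⁽ⁿ⁺¹⁾_μ μ equals adding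
-- vertical strips of weight (1 + t)^(n ∸ k), with k boxes in n rows, to Σ r⁽ⁿ⁾_ν ν.
-- Deleting the entries 1 from a reverse flagged filling and lowering the others shows that r⁽ⁿ⁺¹⁾
-- arises from r⁽ⁿ⁾ by adding vertical strips of weight 1, so the identity follows by induction
-- from two commutation rules: vertical strips with each other, and vertical with horizontal
-- strips. The latter also proves the Pieri rule. The second expansion is the first one
-- multiplied by Π (1 + 2 xᵢ), again by the Pieri rule.
module Submission where

open import Defs
open import Data.Bool using (Bool; true; false; _∧_)
import Data.Bool.Properties as Boolₚ
open import Data.Nat as ℕ using (ℕ; zero; suc; _∸_; _≤_; _<_; _≥_; z≤n; s≤s; _≤ᵇ_; _<ᵇ_)
open import Data.Nat.ListAction using (sum)
import Data.Nat.Properties as ℕₚ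
open import Data.Fin using (Fin; zero; suc; toℕ; inject₁; fromℕ)
import Data.Fin.Properties as Finₚ
open import Data.List using (List; []; _∷_; _∷ʳ_; _++_; map; concatMap; concat; foldr; length; filterᵇ; upTo; replicate; allFin; tabulate)
import Data.List.Properties as Listₚ
open import Data.List.Relation.Unary.All as All using (All; []; _∷_)
import Data.List.Relation.Unary.All.Properties as Allₚ
open import Data.Product using (_×_; _,_; proj₂)
open import Data.Sum using (_⊎_; inj₁; inj₂)
open import Function using (_∘_; id)
open import Relation.Nullary using (yes; no; contradiction)
open import Relation.Binary using (tri<; tri≈; tri>)
open import Relation.Binary.PropositionalEquality as ≡ using (_≡_)
open import Algebra.Bundles using (CommutativeRing)

-- The Schur polynomials are evaluated at elements of an arbitrary commutative ring, so coefficients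
-- cannot be compared through linear independence and no weight can be cancelled. The commutation
-- rules are therefore proved on coefficients: both endpoints are fixed and the intermediate
-- partition is summed over. They do not hold term by term. Each row of the intermediate partition
-- bounds the next one, so the proofs recurse over the rows, carry a ceiling on the first row, and
-- compare sums whose ceiling binds with sums whose ceiling does not. The weight 1 + t comes from
-- the bottom row that the shapes gain with one more variable. If this row ends empty, it was either
-- left empty (weight 1) or given a box that the horizontal strip removed again (weight t); if it
-- ends with one box, the weight is 1. The exchange of vertical and horizontal strips is exact
-- except in this bottom row. The rows above get the weight 1 + t from the induction, where two
-- vertical strips of different weights have to change places.

module Expansion {c ℓ} (R : CommutativeRing c ℓ) where

  open CommutativeRing R hiding (zero)
  open import Relation.Binary.Reasoning.Setoid setoid
  open import Algebra.Solver.Ring.NaturalCoefficients.Default commutativeSemiring using (solve; _:+_; _:*_; _:=_; con)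

  private variable
    A B : Set

  -- Indicators and finite sums in the ring

  ⟦_⟧ : Bool → Carrier
  ⟦ true ⟧  = 1#
  ⟦ false ⟧ = 0#

  ⟦∧⟧ : ∀ p q → ⟦ p ∧ q ⟧ ≈ ⟦ p ⟧ * ⟦ q ⟧
  ⟦∧⟧ true  q = sym (*-identityˡ _)
  ⟦∧⟧ false q = sym (zeroˡ _)

  ⟦∧∧⟧ : ∀ p q r s → ⟦ (p ∧ q) ∧ (r ∧ s) ⟧ ≈ (⟦ p ⟧ * ⟦ q ⟧) * (⟦ r ⟧ * ⟦ s ⟧)
  ⟦∧∧⟧ p q r s = trans (⟦∧⟧ (p ∧ q) (r ∧ s)) (*-cong (⟦∧⟧ p q) (⟦∧⟧ r s))

  *-zero-middle : ∀ {x y z} → y ≈ 0# → x * (y * z) ≈ 0#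
  *-zero-middle {x} {y} {z} y≈0 = begin
    x * (y * z)  ≈⟨ *-congˡ (*-congʳ y≈0) ⟩
    x * (0# * z) ≈⟨ *-congˡ (zeroˡ z) ⟩
    x * 0#       ≈⟨ zeroʳ x ⟩
    0#           ∎

  *-zeroˡ : ∀ {x y} → x ≈ 0# → x * y ≈ 0#
  *-zeroˡ x≈0 = trans (*-congʳ x≈0) (zeroˡ _)

  *-zeroʳ : ∀ {x y} → y ≈ 0# → x * y ≈ 0#
  *-zeroʳ y≈0 = trans (*-congˡ y≈0) (zeroʳ _)

  *-leftComm : ∀ x y z → x * (y * z) ≈ y * (x * z)
  *-leftComm = solve 3 (λ x y z → x :* (y :* z) := y :* (x :* z)) refl

  ∑ : List A → (A → Carrier) → Carrier
  ∑ xs f = sumR R (map f xs)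

  ∑-congAll : ∀ {xs : List A} {f g : A → Carrier} → All (λ a → f a ≈ g a) xs → ∑ xs f ≈ ∑ xs g
  ∑-congAll []       = refl
  ∑-congAll (e ∷ es) = +-cong e (∑-congAll es)

  ∑-cong : ∀ (xs : List A) {f g : A → Carrier} → (∀ a → f a ≈ g a) → ∑ xs f ≈ ∑ xs g
  ∑-cong xs e = ∑-congAll (All.universal e xs)

  ∑-const0 : ∀ (xs : List A) → ∑ xs (λ _ → 0#) ≈ 0#
  ∑-const0 []       = refl
  ∑-const0 (x ∷ xs) = trans (+-identityˡ _) (∑-const0 xs)

  ∑-zeroAll : ∀ {xs : List A} {f : A → Carrier} → All (λ a → f a ≈ 0#) xs → ∑ xs f ≈ 0#
  ∑-zeroAll {xs = xs} e = trans (∑-congAll e) (∑-const0 xs)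

  ∑-zero : ∀ (xs : List A) {f : A → Carrier} → (∀ a → f a ≈ 0#) → ∑ xs f ≈ 0#
  ∑-zero xs e = ∑-zeroAll (All.universal e xs)

  ∑-+ : ∀ (xs : List A) (f g : A → Carrier) → ∑ xs (λ a → f a + g a) ≈ ∑ xs f + ∑ xs g
  ∑-+ []       f g = sym (+-identityˡ 0#)
  ∑-+ (x ∷ xs) f g = begin
    (f x + g x) + ∑ xs (λ a → f a + g a) ≈⟨ +-congˡ (∑-+ xs f g) ⟩
    (f x + g x) + (∑ xs f + ∑ xs g)      ≈⟨ solve 4 (λ a b c d → (a :+ b) :+ (c :+ d) := (a :+ c) :+ (b :+ d)) refl (f x) (g x) (∑ xs f) (∑ xs g) ⟩
    (f x + ∑ xs f) + (g x + ∑ xs g)      ∎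

  ∑-*ˡ : ∀ (xs : List A) k (f : A → Carrier) → ∑ xs (λ a → k * f a) ≈ k * ∑ xs f
  ∑-*ˡ []       k f = sym (zeroʳ k)
  ∑-*ˡ (x ∷ xs) k f = trans (+-congˡ (∑-*ˡ xs k f)) (sym (distribˡ k _ _))

  ∑-*ʳ : ∀ (xs : List A) k (f : A → Carrier) → ∑ xs (λ a → f a * k) ≈ ∑ xs f * k
  ∑-*ʳ xs k f = trans (∑-cong xs (λ a → *-comm (f a) k)) (trans (∑-*ˡ xs k f) (*-comm k _))

  ∑-swap : ∀ (xs : List A) (ys : List B) (f : A → B → Carrier) →
           ∑ xs (λ a → ∑ ys (f a)) ≈ ∑ ys (λ b → ∑ xs (λ a → f a b))
  ∑-swap []       ys f = sym (∑-const0 ys)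
  ∑-swap (x ∷ xs) ys f = trans (+-congˡ (∑-swap xs ys f)) (sym (∑-+ ys (f x) _))

  ∑-map : ∀ (xs : List A) (g : A → B) (f : B → Carrier) → ∑ (map g xs) f ≈ ∑ xs (f ∘ g)
  ∑-map []       g f = refl
  ∑-map (x ∷ xs) g f = +-congˡ (∑-map xs g f)

  ∑-++ : ∀ (xs ys : List A) (f : A → Carrier) → ∑ (xs ++ ys) f ≈ ∑ xs f + ∑ ys f
  ∑-++ []       ys f = sym (+-identityˡ _)
  ∑-++ (x ∷ xs) ys f = trans (+-congˡ (∑-++ xs ys f)) (sym (+-assoc _ _ _))

  ∑-concatMap : ∀ (xs : List A) (g : A → List B) (f : B → Carrier) →
                ∑ (concatMap g xs) f ≈ ∑ xs (λ a → ∑ (g a) f)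
  ∑-concatMap []       g f = refl
  ∑-concatMap (x ∷ xs) g f = trans (∑-++ (g x) _ f) (+-congˡ (∑-concatMap xs g f))

  ∑-concatMap-map : ∀ {C : Set} (xs : List A) (ys : A → List B) (g : A → B → C) (f : C → Carrier) →
                    ∑ (concatMap (λ a → map (g a) (ys a)) xs) f ≈ ∑ xs (λ a → ∑ (ys a) (λ b → f (g a b)))
  ∑-concatMap-map xs ys g f = trans (∑-concatMap xs _ f) (∑-cong xs (λ a → ∑-map (ys a) (g a) f))

  ∑-filter : ∀ (xs : List A) (p : A → Bool) (f : A → Carrier) →
             ∑ (filterᵇ p xs) f ≈ ∑ xs (λ a → ⟦ p a ⟧ * f a)
  ∑-filter []       p f = refl
  ∑-filter (x ∷ xs) p f with p x
  ... | true  = +-cong (sym (*-identityˡ _)) (∑-filter xs p f)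
  ... | false = trans (∑-filter xs p f) (sym (trans (+-congʳ (zeroˡ _)) (+-identityˡ _)))

  ∑-composeʳ : ∀ (xs : List A) (ys : List B) (f : A → Carrier) (g : A → B → Carrier) (k : B → Carrier) →
               ∑ xs (λ a → f a * ∑ ys (λ b → g a b * k b)) ≈ ∑ ys (λ b → ∑ xs (λ a → f a * g a b) * k b)
  ∑-composeʳ xs ys f g k = begin
    ∑ xs (λ a → f a * ∑ ys (λ b → g a b * k b))
      ≈⟨ ∑-cong xs (λ a → trans (sym (∑-*ˡ ys (f a) _)) (∑-cong ys (λ b → sym (*-assoc _ _ _)))) ⟩
    ∑ xs (λ a → ∑ ys (λ b → f a * g a b * k b))
      ≈⟨ ∑-swap xs ys _ ⟩
    ∑ ys (λ b → ∑ xs (λ a → f a * g a b * k b))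
      ≈⟨ ∑-cong ys (λ b → ∑-*ʳ xs (k b) _) ⟩
    ∑ ys (λ b → ∑ xs (λ a → f a * g a b) * k b) ∎

  -- Sums over the range 0, …, N

  upTo-suc : ∀ n → upTo (suc n) ≡ 0 ∷ map suc (upTo n)
  upTo-suc n = ≡.cong (0 ∷_) (≡.sym (Listₚ.map-upTo suc n))

  ∑≤-suc : ∀ N (f : ℕ → Carrier) → ∑ (zeroTo (suc N)) f ≈ f 0 + ∑ (zeroTo N) (f ∘ suc)
  ∑≤-suc N f = trans (reflexive (≡.cong (λ xs → ∑ xs f) (upTo-suc (suc N)))) (+-congˡ (∑-map (zeroTo N) suc f))

  zeroTo-≤ : ∀ N → All (_≤ N) (zeroTo N)
  zeroTo-≤ zero    = z≤n ∷ []
  zeroTo-≤ (suc N) = ≡.subst (All (_≤ suc N)) (≡.sym (upTo-suc (suc N))) (z≤n ∷ Allₚ.map⁺ (All.map s≤s (zeroTo-≤ N)))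

  -- Recursive in both arguments, so that a common `suc` cancels by computation; `_≤ᵇ_` passes
  -- through `_<ᵇ_` and does not do this.
  le : ℕ → ℕ → Carrier
  le zero    n       = 1#
  le (suc m) zero    = 0#
  le (suc m) (suc n) = le m n

  le-≤ : ∀ {m n} → m ≤ n → le m n ≈ 1#
  le-≤ z≤n       = refl
  le-≤ (s≤s m≤n) = le-≤ m≤n

  le-> : ∀ {m n} → n < m → le m n ≈ 0#
  le-> (s≤s z≤n)         = refl
  le-> (s≤s (s≤s n<m)) = le-> (s≤s n<m)

  ⟦≤ᵇ⟧ : ∀ m n → ⟦ m ≤ᵇ n ⟧ ≈ le m n
  ⟦≤ᵇ⟧ zero          n       = refl
  ⟦≤ᵇ⟧ (suc m)       zero    = refl
  ⟦≤ᵇ⟧ (suc zero)    (suc n) = refl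
  ⟦≤ᵇ⟧ (suc (suc m)) (suc n) = ⟦≤ᵇ⟧ (suc m) n

  -- Both sides run over `v` up to the minimum of `M` and `N`. This trades the end of a summation
  -- range for an indicator.
  ∑≤-exchange : ∀ M N (f : ℕ → Carrier) →
                ∑ (zeroTo M) (λ v → le v N * f v) ≈ ∑ (zeroTo N) (λ v → le v M * f v)
  ∑≤-exchange zero    zero    f = refl
  ∑≤-exchange zero    (suc N) f = begin
    ∑ (zeroTo 0) (λ v → le v (suc N) * f v) ≈⟨ +-identityʳ _ ⟩
    1# * f 0                                ≈⟨ +-identityʳ _ ⟨
    1# * f 0 + 0#                           ≈⟨ +-congˡ (∑-zero (zeroTo N) (λ v → zeroˡ _)) ⟨
    _                                       ≈⟨ ∑≤-suc N _ ⟨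
    ∑ (zeroTo (suc N)) (λ v → le v 0 * f v) ∎
  ∑≤-exchange (suc M) zero    f = sym (∑≤-exchange zero (suc M) f)
  ∑≤-exchange (suc M) (suc N) f = begin
    _ ≈⟨ ∑≤-suc M _ ⟩
    _ ≈⟨ +-congˡ (∑≤-exchange M N (f ∘ suc)) ⟩
    _ ≈⟨ ∑≤-suc N _ ⟨
    _ ∎

  ∑≤-bounded : ∀ N (f : ℕ → Carrier) → ∑ (zeroTo N) (λ v → le v N * f v) ≈ ∑ (zeroTo N) f
  ∑≤-bounded N f = ∑-congAll (All.map (λ v≤N → trans (*-congʳ (le-≤ v≤N)) (*-identityˡ _)) (zeroTo-≤ N))

  -- The weights  [l ≤ k] t^(k ∸ l)  and  [w = v] a + [w = v + 1] b

  h : Carrier → ℕ → ℕ → Carrier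
  h t zero    zero    = 1#
  h t (suc k) zero    = t * h t k zero
  h t zero    (suc l) = 0#
  h t (suc k) (suc l) = h t k l

  h-< : ∀ t {k l} → k < l → h t k l ≈ 0#
  h-< t {zero}  {suc l} k<l       = refl
  h-< t {suc k} {suc l} (s≤s k<l) = h-< t k<l

  h-suc : ∀ t {k l} → l ≤ k → h t (suc k) l ≈ t * h t k l
  h-suc t {k} {zero} l≤k = refl
  h-suc t {suc k} {suc l} (s≤s l≤k) = h-suc t l≤k

  h-∸ : ∀ t k l → h t k l ≈ le l k * h t (k ∸ l) 0
  h-∸ t zero    zero    = sym (*-identityˡ _)
  h-∸ t (suc k) zero    = sym (*-identityˡ _)
  h-∸ t zero    (suc l) = sym (zeroˡ _)
  h-∸ t (suc k) (suc l) = h-∸ t k l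

  u : Carrier → Carrier → ℕ → ℕ → Carrier
  u a b zero    zero          = a
  u a b zero    (suc zero)    = b
  u a b zero    (suc (suc w)) = 0#
  u a b (suc v) zero          = 0#
  u a b (suc v) (suc w)       = u a b v w

  u-diag : ∀ a b v → u a b v v ≈ a
  u-diag a b zero    = refl
  u-diag a b (suc v) = u-diag a b v

  u-suc : ∀ a b v → u a b v (suc v) ≈ b
  u-suc a b zero    = refl
  u-suc a b (suc v) = u-suc a b v

  u-< : ∀ a b {v w} → w < v → u a b v w ≈ 0#
  u-< a b {suc v} {zero}  w<v       = refl
  u-< a b {suc v} {suc w} (s≤s w<v) = u-< a b w<v

  u-≫ : ∀ a b {v w} → suc v < w → u a b v w ≈ 0#
  u-≫ a b {zero}  {suc (suc w)} (s≤s _)   = refl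
  u-≫ a b {zero}  {suc zero} (s≤s ())
  u-≫ a b {suc v} {suc w}       (s≤s v<w) = u-≫ a b v<w

  -- Only `w = v` and `w = suc v` carry weight; the `le` factors tell whether they lie in the range.
  ∑-uʳ : ∀ a b N v (f : ℕ → Carrier) →
         ∑ (zeroTo N) (λ w → u a b v w * f w) ≈ le v N * (a * f v) + le (suc v) N * (b * f (suc v))
  ∑-uʳ a b zero zero f = begin
    _ ≈⟨ +-identityʳ _ ⟩
    a * f 0 ≈⟨ solve 2 (λ x y → x := con 1 :* x :+ con 0 :* y) refl (a * f 0) (b * f 1) ⟩
    _ ∎
  ∑-uʳ a b zero (suc v) f = begin
    _ ≈⟨ +-identityʳ _ ⟩
    0# * f 0 ≈⟨ solve 3 (λ x y z → con 0 :* z := con 0 :* x :+ con 0 :* y) refl (a * f (suc v)) (b * f (suc (suc v))) (f 0) ⟩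
    _ ∎
  ∑-uʳ a b (suc N) zero f = begin
    _ ≈⟨ ∑≤-suc N _ ⟩
    a * f 0 + ∑ (zeroTo N) (λ w → u a b 0 (suc w) * f (suc w)) ≈⟨ +-cong (sym (*-identityˡ _)) (tail N) ⟩
    1# * (a * f 0) + 1# * (b * f 1) ∎
    where
    tail : ∀ N → ∑ (zeroTo N) (λ w → u a b 0 (suc w) * f (suc w)) ≈ 1# * (b * f 1)
    tail zero    = trans (+-identityʳ _) (sym (*-identityˡ _))
    tail (suc N) = begin
      _ ≈⟨ ∑≤-suc N _ ⟩
      b * f 1 + ∑ (zeroTo N) (λ w → 0# * f (suc (suc w))) ≈⟨ +-cong (sym (*-identityˡ _)) (∑-zero (zeroTo N) (λ w → zeroˡ _)) ⟩
      1# * (b * f 1) + 0# ≈⟨ +-identityʳ _ ⟩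
      _ ∎
  ∑-uʳ a b (suc N) (suc v) f = begin
    _ ≈⟨ ∑≤-suc N _ ⟩
    0# * f 0 + ∑ (zeroTo N) (λ w → u a b v w * f (suc w)) ≈⟨ +-cong (zeroˡ _) (∑-uʳ a b N v (f ∘ suc)) ⟩
    0# + _ ≈⟨ +-identityˡ _ ⟩
    _ ∎

  ∑-uˡ-zero : ∀ a b N (f : ℕ → Carrier) → ∑ (zeroTo N) (λ v → u a b v 0 * f v) ≈ a * f 0
  ∑-uˡ-zero a b zero    f = +-identityʳ _
  ∑-uˡ-zero a b (suc N) f = begin
    _ ≈⟨ ∑≤-suc N _ ⟩
    a * f 0 + ∑ (zeroTo N) (λ v → 0# * f (suc v)) ≈⟨ +-congˡ (∑-zero (zeroTo N) (λ w → zeroˡ _)) ⟩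
    a * f 0 + 0# ≈⟨ +-identityʳ _ ⟩
    _ ∎

  ∑-uˡ-suc : ∀ a b N w (f : ℕ → Carrier) →
             ∑ (zeroTo N) (λ v → u a b v (suc w) * f v) ≈ le (suc w) N * (a * f (suc w)) + le w N * (b * f w)
  ∑-uˡ-suc a b zero zero f = begin
    _ ≈⟨ +-identityʳ _ ⟩
    b * f 0 ≈⟨ solve 2 (λ x y → x := con 0 :* y :+ con 1 :* x) refl (b * f 0) (a * f 1) ⟩
    _ ∎
  ∑-uˡ-suc a b zero (suc w) f = begin
    _ ≈⟨ +-identityʳ _ ⟩
    0# * f 0 ≈⟨ solve 3 (λ x y z → con 0 :* z := con 0 :* x :+ con 0 :* y) refl (a * f (suc (suc w))) (b * f (suc w)) (f 0) ⟩
    _ ∎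
  ∑-uˡ-suc a b (suc N) zero f = begin
    _ ≈⟨ ∑≤-suc N _ ⟩
    b * f 0 + ∑ (zeroTo N) (λ v → u a b v 0 * f (suc v)) ≈⟨ +-cong (sym (*-identityˡ _)) (∑-uˡ-zero a b N (f ∘ suc)) ⟩
    1# * (b * f 0) + a * f 1 ≈⟨ +-comm _ _ ⟩
    a * f 1 + 1# * (b * f 0) ≈⟨ +-congʳ (*-identityˡ _) ⟨
    _ ∎
  ∑-uˡ-suc a b (suc N) (suc w) f = begin
    _ ≈⟨ ∑≤-suc N _ ⟩
    0# * f 0 + ∑ (zeroTo N) (λ v → u a b v (suc w) * f (suc v)) ≈⟨ +-cong (zeroˡ _) (∑-uˡ-suc a b N w (f ∘ suc)) ⟩
    0# + _ ≈⟨ +-identityˡ _ ⟩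
    _ ∎

  -- Sums over partitions with m rows of length at most N

  parts : ℕ → ℕ → List (List ℕ)
  parts N zero    = [] ∷ []
  parts N (suc m) = concatMap (λ v → map (v ∷_) (parts v m)) (zeroTo N)

  data Part : ℕ → ℕ → List ℕ → Set where
    []  : ∀ {N} → Part N 0 []
    _∷_ : ∀ {N m v μ} → v ≤ N → Part v m μ → Part N (suc m) (v ∷ μ)

  parts-Part : ∀ N m → All (Part N m) (parts N m)
  parts-Part N zero    = [] ∷ []
  parts-Part N (suc m) = Allₚ.concat⁺ (Allₚ.map⁺ (All.map (λ {v} v≤N → Allₚ.map⁺ (All.map (v≤N ∷_) (parts-Part v m))) (zeroTo-≤ N)))

  ∑P-cong : ∀ N m {f g : List ℕ → Carrier} → (∀ {μ} → Part N m μ → f μ ≈ g μ) → ∑ (parts N m) f ≈ ∑ (parts N m) g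
  ∑P-cong N m e = ∑-congAll (All.map e (parts-Part N m))

  ∑P-suc : ∀ N m (f : List ℕ → Carrier) →
           ∑ (parts N (suc m)) f ≈ ∑ (zeroTo N) (λ v → ∑ (parts v m) (λ μ → f (v ∷ μ)))
  ∑P-suc N m f = ∑-concatMap-map (zeroTo N) (λ v → parts v m) _∷_ f

  Part-length : ∀ {N m μ} → Part N m μ → length μ ≡ m
  Part-length []      = ≡.refl
  Part-length (_ ∷ p) = ≡.cong suc (Part-length p)

  Part-∷ʳ0 : ∀ {N m μ} → Part N m μ → Part N (suc m) (μ ∷ʳ 0)
  Part-∷ʳ0 []        = z≤n ∷ []
  Part-∷ʳ0 (v≤N ∷ p) = v≤N ∷ Part-∷ʳ0 p

  -- Serves where the summand itself forces an empty last row: a shape with more rows than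
  -- variables, or with more rows than the flags allow.
  ∑P-∷ʳ0 : ∀ N m (f : List ℕ → Carrier) → (∀ {μ} v → length μ ≡ m → Part N (suc m) (μ ∷ʳ suc v) → f (μ ∷ʳ suc v) ≈ 0#) →
           ∑ (parts N (suc m)) f ≈ ∑ (parts N m) (λ μ → f (μ ∷ʳ 0))
  ∑P-∷ʳ0 N zero f z = begin
    _ ≈⟨ ∑P-suc N 0 f ⟩
    ∑ (zeroTo N) (λ v → ∑ (parts v 0) (λ μ → f (v ∷ μ))) ≈⟨ ∑-cong (zeroTo N) (λ v → +-identityʳ _) ⟩
    ∑ (zeroTo N) (λ v → f (v ∷ [])) ≈⟨ head-only N (λ v≤N → v≤N) ⟩
    f (0 ∷ []) ≈⟨ +-identityʳ _ ⟨
    _ ∎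
    where
    head-only : ∀ M → (∀ {v} → v ≤ M → v ≤ N) → ∑ (zeroTo M) (λ v → f (v ∷ [])) ≈ f (0 ∷ [])
    head-only zero    _   = +-identityʳ _
    head-only (suc M) M≤N = trans (∑≤-suc M _) (trans (+-congˡ (∑-zeroAll (All.map (λ {v} v≤M → z {[]} v ≡.refl (M≤N (s≤s v≤M) ∷ [])) (zeroTo-≤ M)))) (+-identityʳ _))
  ∑P-∷ʳ0 N (suc m) f z = begin
    _ ≈⟨ ∑P-suc N (suc m) f ⟩
    _ ≈⟨ ∑-congAll (All.map (λ {v} v≤N → ∑P-∷ʳ0 v m (λ μ → f (v ∷ μ)) (λ w e p → z w (≡.cong suc e) (v≤N ∷ p))) (zeroTo-≤ N)) ⟩
    _ ≈⟨ ∑P-suc N m _ ⟨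
    _ ∎

  ∑P-restrict : ∀ {M N} m (f : List ℕ → Carrier) → M ≤ N → (∀ {v μ} → M < v → f (v ∷ μ) ≈ 0#) →
                ∑ (parts N m) f ≈ ∑ (parts M m) f
  ∑P-restrict zero f M≤N z = refl
  ∑P-restrict {M} {N} (suc m) f M≤N z = begin
    _ ≈⟨ ∑P-suc N m f ⟩
    ∑ (zeroTo N) (λ v → F v)          ≈⟨ ∑-cong (zeroTo N) bound ⟩
    ∑ (zeroTo N) (λ v → le v M * F v) ≈⟨ ∑≤-exchange N M F ⟩
    ∑ (zeroTo M) (λ v → le v N * F v) ≈⟨ ∑-congAll (All.map (λ v≤M → trans (*-congʳ (le-≤ (ℕₚ.≤-trans v≤M M≤N))) (*-identityˡ _)) (zeroTo-≤ M)) ⟩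
    ∑ (zeroTo M) (λ v → F v)          ≈⟨ ∑P-suc M m f ⟨
    _ ∎
    where
    F = λ v → ∑ (parts v m) (λ μ → f (v ∷ μ))
    bound : ∀ v → F v ≈ le v M * F v
    bound v with v ℕ.≤? M
    ... | yes v≤M = sym (trans (*-congʳ (le-≤ v≤M)) (*-identityˡ _))
    ... | no v≰M  = trans (∑-zero (parts v m) (λ μ → z (ℕₚ.≰⇒> v≰M))) (sym (*-zeroˡ (le-> (ℕₚ.≰⇒> v≰M))))

  -- Weights of vertical strips and of horizontal strips

  -- The vertical strip  μ/ν  with  k  boxes in  m  rows has weight  a^(m ∸ k) b^k.
  V : Carrier → Carrier → List ℕ → List ℕ → Carrier
  V a b []      []      = 1#
  V a b (v ∷ ν) (w ∷ μ) = u a b v w * V a b ν μ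
  V a b _       _       = 0#

  -- The weight  t^(|μ| ∸ |θ|)  if  c ≥ μ₁ ≥ θ₁ ≥ μ₂ ≥ θ₂ ≥ … ≥ e,  and 0 otherwise.
  H : Carrier → ℕ → ℕ → List ℕ → List ℕ → Carrier
  H t e c []      []      = le e c
  H t e c (v ∷ μ) (l ∷ θ) = le v c * (h t v l * H t e l μ θ)
  H t e c _       _       = 0#

  H-> : ∀ t e {c v} μ θ → c < v → H t e c (v ∷ μ) θ ≈ 0#
  H-> t e μ []      c<v = refl
  H-> t e μ (l ∷ θ) c<v = *-zeroˡ (le-> c<v)

  V-∷ʳ : ∀ a b ν μ v w → length ν ≡ length μ → V a b (ν ∷ʳ v) (μ ∷ʳ w) ≈ V a b ν μ * u a b v w
  V-∷ʳ a b []      []      v w e = *-comm _ _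
  V-∷ʳ a b (x ∷ ν) (y ∷ μ) v w e = trans (*-congˡ (V-∷ʳ a b ν μ v w (ℕₚ.suc-injective e))) (sym (*-assoc _ _ _))

  -- This is the purpose of the floor `e`: once the last rows are split off, `v` still bounds the
  -- last row of `θ` from below, while `l` is tied to `v` alone.
  H-∷ʳ : ∀ t c μ θ v l → length μ ≡ length θ → H t 0 c (μ ∷ʳ v) (θ ∷ʳ l) ≈ H t v c μ θ * h t v l
  H-∷ʳ t c []      []      v l e = *-congˡ (*-identityʳ _)
  H-∷ʳ t c (x ∷ μ) (y ∷ θ) v l e = begin
    le x c * (h t x y * H t 0 y (μ ∷ʳ v) (θ ∷ʳ l)) ≈⟨ *-congˡ (*-congˡ (H-∷ʳ t y μ θ v l (ℕₚ.suc-injective e))) ⟩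
    le x c * (h t x y * (H t v y μ θ * h t v l))   ≈⟨ solve 4 (λ p q r s → p :* (q :* (r :* s)) := (p :* (q :* r)) :* s) refl (le x c) (h t x y) (H t v y μ θ) (h t v l) ⟩
    le x c * (h t x y * H t v y μ θ) * h t v l     ∎

  headOr : ℕ → List ℕ → ℕ
  headOr e []      = e
  headOr e (v ∷ _) = v

  headOr-≤ : ∀ {N m} μ v → Part N (suc m) (μ ∷ʳ v) → headOr v μ ≤ N
  headOr-≤ []      v (v≤N ∷ _) = v≤N
  headOr-≤ (_ ∷ _) v (w≤N ∷ _) = w≤N

  head-≤ : ∀ {N m μ} → Part N m μ → headOr 0 μ ≤ N
  head-≤ []        = z≤n
  head-≤ (v≤N ∷ _) = v≤N

  -- Commutation of vertical strips with horizontal strips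

  module _ (t a b : Carrier) where

    VH : ℕ → ℕ → List ℕ → List ℕ → Carrier
    VH c m ν θ = ∑ (parts c m) (λ μ → V a b ν μ * H t 0 c μ θ)

    HV : ℕ → ℕ → ℕ → List ℕ → List ℕ → Carrier
    HV e c m ν θ = ∑ (parts c m) (λ κ → H t e c ν κ * V a b κ θ)

    -- The two summands are the choices to keep the row `v` or to lengthen it. The indicators have
    -- their own arguments because the two orders differ there: `VH` takes `v' = v` and for `l'` the
    -- row of `θ` above, `HV` takes for `v'` the next row of `ν` and `l' = l`.
    rowWeight : ℕ → ℕ → ℕ → ℕ → Carrier
    rowWeight v l v' l' = le v' l' * (a * h t v l) + le (suc v') l' * (b * h t (suc v) l)

    -- The first row `w` of `μ` bounds the second, but interlacing already bounds the second by
    -- `l ≤ w`. The sum over the remaining rows thus does not depend on `w` and splits off.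
    VH-∷ : ∀ c m v l ν θ → VH c (suc m) (v ∷ ν) (l ∷ θ) ≈ rowWeight v l v c * VH l m ν θ
    VH-∷ c m v l ν θ = begin
      _ ≈⟨ ∑P-suc c m _ ⟩
      ∑ (zeroTo c) (λ w → ∑ (parts w m) (λ μ → (u a b v w * V a b ν μ) * (le w c * (h t w l * H t 0 l μ θ))))
        ≈⟨ ∑-congAll (All.map inner (zeroTo-≤ c)) ⟩
      ∑ (zeroTo c) (λ w → u a b v w * (h t w l * VH l m ν θ))
        ≈⟨ ∑-uʳ a b c v _ ⟩
      le v c * (a * (h t v l * VH l m ν θ)) + le (suc v) c * (b * (h t (suc v) l * VH l m ν θ))
        ≈⟨ solve 7 (λ p q a b x y z → p :* (a :* (x :* z)) :+ q :* (b :* (y :* z)) := (p :* (a :* x) :+ q :* (b :* y)) :* z)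
             refl (le v c) (le (suc v) c) a b (h t v l) (h t (suc v) l) (VH l m ν θ) ⟩
      rowWeight v l v c * VH l m ν θ ∎
      where
      restrict : ∀ w → h t w l * ∑ (parts w m) (λ μ → V a b ν μ * H t 0 l μ θ) ≈ h t w l * VH l m ν θ
      restrict w with l ℕ.≤? w
      ... | yes l≤w = *-congˡ (∑P-restrict m _ l≤w (λ {_} {μ} l<v → *-zeroʳ (H-> t 0 μ θ l<v)))
      ... | no l≰w  = trans (*-zeroˡ (h-< t (ℕₚ.≰⇒> l≰w))) (sym (*-zeroˡ (h-< t (ℕₚ.≰⇒> l≰w))))
      inner : ∀ {w} → w ≤ c → ∑ (parts w m) (λ μ → (u a b v w * V a b ν μ) * (le w c * (h t w l * H t 0 l μ θ)))
                            ≈ u a b v w * (h t w l * VH l m ν θ)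
      inner {w} w≤c = begin
        _ ≈⟨ ∑-cong (parts w m) (λ μ → trans
               (*-congˡ (trans (*-congʳ (le-≤ w≤c)) (*-identityˡ _)))
               (solve 4 (λ p q r s → (p :* q) :* (r :* s) := (p :* r) :* (q :* s)) refl (u a b v w) (V a b ν μ) (h t w l) (H t 0 l μ θ))) ⟩
        ∑ (parts w m) (λ μ → (u a b v w * h t w l) * (V a b ν μ * H t 0 l μ θ)) ≈⟨ ∑-*ˡ (parts w m) _ _ ⟩
        (u a b v w * h t w l) * _ ≈⟨ *-assoc _ _ _ ⟩
        u a b v w * (h t w l * _) ≈⟨ *-congˡ (restrict w) ⟩
        _ ∎

    HV-factor : ℕ → List ℕ → List ℕ → Carrier
    HV-factor e (v ∷ ν) (l ∷ θ) = rowWeight v l (headOr e ν) l * HV-factor e ν θ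
    HV-factor e _       _       = 1#

    -- The first row of `κ` is `l` or `l - 1` and meets the remaining rows only in the comparison
    -- with the next row of `ν`, so the rows decouple. Removing boxes down to `l - 1` and then
    -- adding one has the `h`-weight of lengthening first, since `h t (suc v) (suc l)` computes to
    -- `h t v l`.
    HV-factorises : ∀ e c {m} ν θ → length ν ≡ m → length θ ≡ m →
                    HV e c m ν θ ≈ le (headOr e ν) c * HV-factor e ν θ
    HV-factorises e c {zero}  []      []      _ _ = +-identityʳ _
    HV-factorises e c {suc m} (v ∷ ν) (l ∷ θ) p q = begin
      _ ≈⟨ ∑P-suc c m _ ⟩
      ∑ (zeroTo c) (λ k → ∑ (parts k m) (λ κ → (le v c * (h t v k * H t e k ν κ)) * (u a b k l * V a b κ θ)))
        ≈⟨ ∑-cong (zeroTo c) inner ⟩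
      ∑ (zeroTo c) (λ k → le v c * (u a b k l * F k))
        ≈⟨ ∑-*ˡ (zeroTo c) _ _ ⟩
      le v c * ∑ (zeroTo c) (λ k → u a b k l * F k)
        ≈⟨ outer l ⟩
      le v c * (rowWeight v l (headOr e ν) l * HV-factor e ν θ) ∎
      where
      F = λ k → h t v k * (le (headOr e ν) k * HV-factor e ν θ)
      inner : ∀ k → ∑ (parts k m) (λ κ → (le v c * (h t v k * H t e k ν κ)) * (u a b k l * V a b κ θ))
                  ≈ le v c * (u a b k l * F k)
      inner k = begin
        _ ≈⟨ ∑-cong (parts k m) (λ κ → solve 5 (λ p q r s w → (p :* (q :* r)) :* (s :* w) := (p :* (s :* q)) :* (r :* w)) refl
               (le v c) (h t v k) (H t e k ν κ) (u a b k l) (V a b κ θ)) ⟩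
        _ ≈⟨ ∑-*ˡ (parts k m) _ _ ⟩
        (le v c * (u a b k l * h t v k)) * HV e k m ν θ ≈⟨ *-congˡ (HV-factorises e k ν θ (ℕₚ.suc-injective p) (ℕₚ.suc-injective q)) ⟩
        (le v c * (u a b k l * h t v k)) * (le (headOr e ν) k * HV-factor e ν θ)
          ≈⟨ solve 4 (λ p q r s → (p :* (q :* r)) :* s := p :* (q :* (r :* s))) refl (le v c) (u a b k l) (h t v k) _ ⟩
        _ ∎
      -- The range bound `k ≤ c` is automatic: `h t v k` vanishes unless `k ≤ v`.
      absorb : v ≤ c → ∀ k → le k c * h t v k ≈ h t v k
      absorb v≤c k with k ℕ.≤? c
      ... | yes k≤c = trans (*-congʳ (le-≤ k≤c)) (*-identityˡ _)
      ... | no k≰c  = trans (*-zeroʳ v<k) (sym v<k)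
        where v<k = h-< t (ℕₚ.≤-<-trans v≤c (ℕₚ.≰⇒> k≰c))
      absorb-F : v ≤ c → ∀ x k → le k c * (x * F k) ≈ x * F k
      absorb-F v≤c x k = begin
        le k c * (x * (h t v k * _)) ≈⟨ solve 4 (λ p q r s → p :* (q :* (r :* s)) := q :* ((p :* r) :* s)) refl (le k c) x (h t v k) _ ⟩
        x * ((le k c * h t v k) * _) ≈⟨ *-congˡ (*-congʳ (absorb v≤c k)) ⟩
        _ ∎
      outer : ∀ l → le v c * ∑ (zeroTo c) (λ k → u a b k l * F k)
                  ≈ le v c * (rowWeight v l (headOr e ν) l * HV-factor e ν θ)
      outer l with v ℕ.≤? c
      outer l       | no v≰c = trans (*-zeroˡ (le-> (ℕₚ.≰⇒> v≰c))) (sym (*-zeroˡ (le-> (ℕₚ.≰⇒> v≰c))))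
      outer zero    | yes v≤c = *-congˡ (begin
        _ ≈⟨ ∑-uˡ-zero a b c F ⟩
        a * (h t v 0 * (le (headOr e ν) 0 * HV-factor e ν θ))
          ≈⟨ solve 5 (λ a x p r y → a :* (x :* (p :* r)) := (p :* (a :* x) :+ con 0 :* y) :* r) refl a (h t v 0) (le (headOr e ν) 0) (HV-factor e ν θ) (b * h t (suc v) 0) ⟩
        rowWeight v 0 (headOr e ν) 0 * HV-factor e ν θ ∎)
      outer (suc l) | yes v≤c = *-congˡ (begin
        _ ≈⟨ ∑-uˡ-suc a b c l F ⟩
        le (suc l) c * (a * F (suc l)) + le l c * (b * F l) ≈⟨ +-cong (absorb-F v≤c a (suc l)) (absorb-F v≤c b l) ⟩
        a * F (suc l) + b * F l
          ≈⟨ solve 7 (λ a b x y p q r → a :* (x :* (p :* r)) :+ b :* (y :* (q :* r)) := (p :* (a :* x) :+ q :* (b :* y)) :* r) refl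
               a b (h t v (suc l)) (h t v l) (le (headOr e ν) (suc l)) (le (headOr e ν) l) (HV-factor e ν θ) ⟩
        rowWeight v (suc l) (headOr e ν) (suc l) * HV-factor e ν θ ∎)

    rowWeight-< : ∀ v l {v' l'} → v' < l' → rowWeight v l v' l' ≈ a * h t v l + b * h t (suc v) l
    rowWeight-< v l v'<l' = +-cong (trans (*-congʳ (le-≤ (ℕₚ.<⇒≤ v'<l'))) (*-identityˡ _))
                                   (trans (*-congʳ (le-≤ v'<l')) (*-identityˡ _))

    rowWeight-≡ : ∀ v l v' → rowWeight v l v' v' ≈ a * h t v l
    rowWeight-≡ v l v' = trans (+-cong (trans (*-congʳ (le-≤ {v'} ℕₚ.≤-refl)) (*-identityˡ _)) (*-zeroˡ (le-> {suc v'} ℕₚ.≤-refl))) (+-identityʳ _)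

    rowWeight-> : ∀ v l {v' l'} → l' < v' → rowWeight v l v' l' ≈ 0#
    rowWeight-> v l l'<v' = trans (+-cong (*-zeroˡ (le-> l'<v')) (*-zeroˡ (le-> (ℕₚ.m<n⇒m<1+n l'<v')))) (+-identityʳ _)

    VH-> : ∀ {c} m ν v θ l → c < headOr v ν → VH c (suc m) (ν ∷ʳ v) (θ ∷ʳ l) ≈ 0#
    VH-> m []      v []      l c<v = trans (VH-∷ _ m v l [] []) (*-zeroˡ (rowWeight-> v l c<v))
    VH-> m []      v (y ∷ θ) l c<v = trans (VH-∷ _ m v y [] (θ ∷ʳ l)) (*-zeroˡ (rowWeight-> v y c<v))
    VH-> m (x ∷ ν) v []      l c<x = trans (VH-∷ _ m x l (ν ∷ʳ v) []) (*-zeroˡ (rowWeight-> x l c<x))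
    VH-> m (x ∷ ν) v (y ∷ θ) l c<x = trans (VH-∷ _ m x y (ν ∷ʳ v) (θ ∷ʳ l)) (*-zeroˡ (rowWeight-> x y c<x))

    rowSum : ∀ {v l} → l ≤ v → a * h t v l + b * h t (suc v) l ≈ (a + b * t) * h t v l
    rowSum {v} {l} l≤v = begin
      a * h t v l + b * h t (suc v) l ≈⟨ +-congˡ (*-congˡ (h-suc t l≤v)) ⟩
      a * h t v l + b * (t * h t v l) ≈⟨ solve 4 (λ a b t x → a :* x :+ b :* (t :* x) := (a :+ b :* t) :* x) refl a b t (h t v l) ⟩
      (a + b * t) * h t v l ∎

    -- VH and HV are products over the rows whose indicators differ by a shift of one row.
    -- Both vanish if θᵢ < νᵢ₊₁ for some i, and the shift changes nothing if θᵢ > νᵢ₊₁.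
    -- If θᵢ = νᵢ₊₁, then θ ≤ ν in the rows i and i + 1, where h (suc v) l = t * h v l, so a
    -- discrepancy  a + b t : a  is created in row i and handed down until the next row with θᵢ > νᵢ₊₁.
    VH-free : ∀ {M N m c} ν v θ l → Part M (suc m) (ν ∷ʳ v) → Part N (suc m) (θ ∷ʳ l) → headOr v ν < c →
              VH c (suc m) (ν ∷ʳ v) (θ ∷ʳ l) ≈ HV-factor v ν θ * (a * h t v l + b * h t (suc v) l)
    VH-tight : ∀ {M N m} ν v θ l → Part M (suc m) (ν ∷ʳ v) → Part N (suc m) (θ ∷ʳ l) → headOr l θ ≤ headOr v ν →
               (a + b * t) * VH (headOr v ν) (suc m) (ν ∷ʳ v) (θ ∷ʳ l)
               ≈ a * (HV-factor v ν θ * (a * h t v l + b * h t (suc v) l))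

    VH-free {c = c} [] v [] l (_ ∷ []) (_ ∷ []) v<c = begin
      _ ≈⟨ VH-∷ c 0 v l [] [] ⟩
      rowWeight v l v c * VH l 0 [] [] ≈⟨ *-cong (rowWeight-< v l v<c) (trans (+-identityʳ _) (*-identityʳ _)) ⟩
      _ * 1# ≈⟨ *-comm _ _ ⟩
      _ ∎
    VH-free [] v (_ ∷ []) l (_ ∷ []) (_ ∷ ()) v<c
    VH-free [] v (_ ∷ _ ∷ _) l (_ ∷ []) (_ ∷ ()) v<c
    VH-free (_ ∷ []) v [] l (_ ∷ ()) (_ ∷ []) v<c
    VH-free (_ ∷ _ ∷ _) v [] l (_ ∷ ()) (_ ∷ []) v<c
    VH-free {m = suc m} {c} (x ∷ ν) v (y ∷ θ) l (_ ∷ p) (_ ∷ q) x<c with ℕₚ.<-cmp (headOr v ν) y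
    ... | tri< n<y _ _ = begin
      _ ≈⟨ VH-∷ c (suc m) x y (ν ∷ʳ v) (θ ∷ʳ l) ⟩
      rowWeight x y x c * VH y (suc m) (ν ∷ʳ v) (θ ∷ʳ l) ≈⟨ *-cong (trans (rowWeight-< x y x<c) (sym (rowWeight-< x y n<y))) (VH-free ν v θ l p q n<y) ⟩
      rowWeight x y (headOr v ν) y * (HV-factor v ν θ * _) ≈⟨ *-assoc _ _ _ ⟨
      _ ∎
    ... | tri≈ _ ≡.refl _ = begin
      _ ≈⟨ VH-∷ c (suc m) x y (ν ∷ʳ v) (θ ∷ʳ l) ⟩
      rowWeight x y x c * VH y (suc m) (ν ∷ʳ v) (θ ∷ʳ l) ≈⟨ *-congʳ (trans (rowWeight-< x y x<c) (rowSum (headOr-≤ ν v p))) ⟩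
      ((a + b * t) * h t x y) * VH y (suc m) (ν ∷ʳ v) (θ ∷ʳ l)
        ≈⟨ solve 3 (λ p q r → (p :* q) :* r := q :* (p :* r)) refl (a + b * t) (h t x y) _ ⟩
      h t x y * ((a + b * t) * VH y (suc m) (ν ∷ʳ v) (θ ∷ʳ l)) ≈⟨ *-congˡ (VH-tight ν v θ l p q (headOr-≤ θ l q)) ⟩
      h t x y * (a * (HV-factor v ν θ * _)) ≈⟨ solve 4 (λ p q r s → p :* (q :* (r :* s)) := ((q :* p) :* r) :* s) refl (h t x y) a (HV-factor v ν θ) _ ⟩
      ((a * h t x y) * HV-factor v ν θ) * _ ≈⟨ *-congʳ (*-congʳ (rowWeight-≡ x y y)) ⟨
      _ ∎
    ... | tri> _ _ y<n = begin
      _ ≈⟨ VH-∷ c (suc m) x y (ν ∷ʳ v) (θ ∷ʳ l) ⟩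
      rowWeight x y x c * VH y (suc m) (ν ∷ʳ v) (θ ∷ʳ l) ≈⟨ *-zeroʳ (VH-> m ν v θ l y<n) ⟩
      0# ≈⟨ *-zeroˡ (*-zeroˡ (rowWeight-> x y y<n)) ⟨
      _ ∎

    VH-tight [] v [] l (_ ∷ []) (_ ∷ []) l≤v = begin
      (a + b * t) * VH v 1 (v ∷ []) (l ∷ []) ≈⟨ *-congˡ (VH-∷ v 0 v l [] []) ⟩
      (a + b * t) * (rowWeight v l v v * VH l 0 [] []) ≈⟨ *-congˡ (*-cong (rowWeight-≡ v l v) (trans (+-identityʳ _) (*-identityʳ _))) ⟩
      (a + b * t) * ((a * h t v l) * 1#) ≈⟨ solve 3 (λ p a x → p :* ((a :* x) :* con 1) := a :* (con 1 :* (p :* x))) refl (a + b * t) a (h t v l) ⟩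
      a * (1# * ((a + b * t) * h t v l)) ≈⟨ *-congˡ (*-congˡ (rowSum l≤v)) ⟨
      _ ∎
    VH-tight [] v (_ ∷ []) l (_ ∷ []) (_ ∷ ()) v<c
    VH-tight [] v (_ ∷ _ ∷ _) l (_ ∷ []) (_ ∷ ()) v<c
    VH-tight (_ ∷ []) v [] l (_ ∷ ()) (_ ∷ []) v<c
    VH-tight (_ ∷ _ ∷ _) v [] l (_ ∷ ()) (_ ∷ []) v<c
    VH-tight {m = suc m} (x ∷ ν) v (y ∷ θ) l (_ ∷ p) (_ ∷ q) y≤x = begin
      (a + b * t) * VH x (suc (suc m)) (x ∷ ν ∷ʳ v) (y ∷ θ ∷ʳ l) ≈⟨ *-congˡ (VH-∷ x (suc m) x y (ν ∷ʳ v) (θ ∷ʳ l)) ⟩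
      (a + b * t) * (rowWeight x y x x * W) ≈⟨ *-congˡ (*-congʳ (rowWeight-≡ x y x)) ⟩
      (a + b * t) * ((a * h t x y) * W) ≈⟨ compare ⟩
      a * (rowWeight x y (headOr v ν) y * (HV-factor v ν θ * E)) ≈⟨ *-congˡ (*-assoc _ _ _) ⟨
      a * (rowWeight x y (headOr v ν) y * HV-factor v ν θ * E) ∎
      where
      W = VH y (suc m) (ν ∷ʳ v) (θ ∷ʳ l)
      E = a * h t v l + b * h t (suc v) l
      compare : (a + b * t) * ((a * h t x y) * W) ≈ a * (rowWeight x y (headOr v ν) y * (HV-factor v ν θ * E))
      compare with ℕₚ.<-cmp (headOr v ν) y
      ... | tri< n<y _ _ = begin
        (a + b * t) * ((a * h t x y) * W) ≈⟨ solve 4 (λ p a x w → p :* ((a :* x) :* w) := a :* ((p :* x) :* w)) refl (a + b * t) a (h t x y) W ⟩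
        a * (((a + b * t) * h t x y) * W) ≈⟨ *-congˡ (*-cong (trans (sym (rowSum y≤x)) (sym (rowWeight-< x y n<y))) (VH-free ν v θ l p q n<y)) ⟩
        _ ∎
      ... | tri≈ _ ≡.refl _ = begin
        (a + b * t) * ((a * h t x y) * W) ≈⟨ solve 3 (λ p x w → p :* (x :* w) := x :* (p :* w)) refl (a + b * t) (a * h t x y) W ⟩
        (a * h t x y) * ((a + b * t) * W) ≈⟨ *-congˡ (VH-tight ν v θ l p q (headOr-≤ θ l q)) ⟩
        (a * h t x y) * (a * (HV-factor v ν θ * E)) ≈⟨ *-leftComm _ _ _ ⟩
        a * ((a * h t x y) * (HV-factor v ν θ * E)) ≈⟨ *-congˡ (*-congʳ (rowWeight-≡ x y y)) ⟨
        _ ∎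
      ... | tri> _ _ y<n = trans (*-zeroʳ (*-zeroʳ (VH-> m ν v θ l y<n))) (sym (*-zeroʳ (*-zeroˡ (rowWeight-> x y y<n))))

    -- The last row has no successor to hand its indicator to, so it is left over as a factor. This
    -- factor has two uses: for `l = 0` it is `(a + b * t) * h t v 0`, which supplies a new factor
    -- of the Pieri product, and for `v = 0`, `a = b = 1` it is the vertical strip weight
    -- `u (1# + t) 1# 0 l`.
    VH≈HV : ∀ {N M m} ν v θ l → Part N (suc m) (ν ∷ʳ v) → Part M (suc m) (θ ∷ʳ l) → length ν ≡ m → length θ ≡ m →
            VH (suc N) (suc m) (ν ∷ʳ v) (θ ∷ʳ l) ≈ HV v N m ν θ * (a * h t v l + b * h t (suc v) l)
    VH≈HV {N} {m = m} ν v θ l p q eν eθ = begin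
      _ ≈⟨ VH-free ν v θ l p q (s≤s (headOr-≤ ν v p)) ⟩
      HV-factor v ν θ * E                      ≈⟨ *-congʳ (*-identityˡ _) ⟨
      1# * HV-factor v ν θ * E                 ≈⟨ *-congʳ (*-congʳ (le-≤ (headOr-≤ ν v p))) ⟨
      le (headOr v ν) N * HV-factor v ν θ * E  ≈⟨ *-congʳ (HV-factorises v N ν θ eν eθ) ⟨
      HV v N m ν θ * E                         ∎
      where E = a * h t v l + b * h t (suc v) l

  -- Commutation of two vertical strips

  module _ (a b a' b' : Carrier) where

    VV : ℕ → ℕ → List ℕ → List ℕ → Carrier
    VV c m ν θ = ∑ (parts c m) (λ κ → V a b ν κ * V a' b' κ θ)

    VV-∷ : ∀ c m v l ν θ → VV c (suc m) (v ∷ ν) (l ∷ θ) ≈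
           le v c * (a * (u a' b' v l * VV v m ν θ)) + le (suc v) c * (b * (u a' b' (suc v) l * VV (suc v) m ν θ))
    VV-∷ c m v l ν θ = begin
      _ ≈⟨ ∑P-suc c m _ ⟩
      ∑ (zeroTo c) (λ k → ∑ (parts k m) (λ κ → (u a b v k * V a b ν κ) * (u a' b' k l * V a' b' κ θ)))
        ≈⟨ ∑-cong (zeroTo c) (λ k → trans (∑-cong (parts k m) (λ κ →
             solve 4 (λ p q r s → (p :* q) :* (r :* s) := (p :* r) :* (q :* s)) refl (u a b v k) (V a b ν κ) (u a' b' k l) (V a' b' κ θ)))
             (trans (∑-*ˡ (parts k m) _ _) (*-assoc _ _ _))) ⟩
      ∑ (zeroTo c) (λ k → u a b v k * (u a' b' k l * VV k m ν θ))
        ≈⟨ ∑-uʳ a b c v _ ⟩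
      _ ∎

    VV-low : ∀ {c} m {v l} ν θ → v ≤ c → l ≤ v →
             VV c (suc m) (v ∷ ν) (l ∷ θ) ≈ a * (u a' b' v l * VV v m ν θ)
    VV-low {c} m {v} {l} ν θ v≤c l≤v = begin
      _ ≈⟨ VV-∷ c m v l ν θ ⟩
      _ ≈⟨ +-cong (trans (*-congʳ (le-≤ v≤c)) (*-identityˡ _)) (*-zeroʳ (*-zero-middle (u-< a' b' (s≤s l≤v)))) ⟩
      _ + 0# ≈⟨ +-identityʳ _ ⟩
      _ ∎

    VV-full : ∀ {c} m {v} l ν θ → v < c → VV c (suc m) (v ∷ ν) (l ∷ θ) ≈
              a * (u a' b' v l * VV v m ν θ) + b * (u a' b' (suc v) l * VV (suc v) m ν θ)
    VV-full m l ν θ v<c = trans (VV-∷ _ m _ l ν θ)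
      (+-cong (trans (*-congʳ (le-≤ (ℕₚ.<⇒≤ v<c))) (*-identityˡ _)) (trans (*-congʳ (le-≤ v<c)) (*-identityˡ _)))

    VV-suc : ∀ {c} m v ν θ → v < c → VV c (suc m) (v ∷ ν) (suc v ∷ θ) ≈
             (a * b') * VV v m ν θ + (b * a') * VV (suc v) m ν θ
    VV-suc m v ν θ v<c = trans (VV-full m (suc v) ν θ v<c)
      (+-cong (trans (*-congˡ (*-congʳ (u-suc a' b' v))) (sym (*-assoc _ _ _)))
              (trans (*-congˡ (*-congʳ (u-diag a' b' v))) (sym (*-assoc _ _ _))))

    VV-suc-tight : ∀ m v ν θ → VV v (suc m) (v ∷ ν) (suc v ∷ θ) ≈ (a * b') * VV v m ν θ
    VV-suc-tight m v ν θ = begin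
      _ ≈⟨ VV-∷ v m v (suc v) ν θ ⟩
      _ ≈⟨ +-cong (trans (*-congʳ (le-≤ {v} ℕₚ.≤-refl)) (*-identityˡ _)) (*-zeroˡ (le-> {suc v} ℕₚ.≤-refl)) ⟩
      _ + 0# ≈⟨ +-identityʳ _ ⟩
      a * (u a' b' v (suc v) * VV v m ν θ) ≈⟨ trans (*-congˡ (*-congʳ (u-suc a' b' v))) (sym (*-assoc _ _ _)) ⟩
      _ ∎

  module _ (a b a' b' : Carrier) where
    private
      W = VV a b a' b'
      W′ = VV a' b' a b
      X = a * b'
      Y = b * a'

    -- If the first row grows by 0 or 2 boxes, the part of each strip in it is forced. If it grows
    -- by one, either strip may supply the box, and the two options leave the different ceilings `v`
    -- and `suc v` to the rows below. `VV-comm-step` treats this pair of ceilings together.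
    VV-comm : ∀ {N M m c ν θ} → Part N m ν → Part M m θ → headOr 0 ν < c → W c m ν θ ≈ W′ c m ν θ

    -- Terms of nonzero weight have `κ` inside `θ`, so a ceiling that `θ` respects excludes none of
    -- them.
    VV-comm-low : ∀ {v m ν θ} → Part v m ν → Part v m θ → W v m ν θ ≈ W′ v m ν θ

    -- Rows in which θ exceeds ν by exactly one box offer a choice, of weight X or Y; in a
    -- maximal run of such rows of equal length the total is the complete homogeneous
    -- symmetric polynomial in X and Y.
    VV-comm-step : ∀ {v m ν θ} → Part v m ν → Part (suc v) m θ →
                   X * W v m ν θ + Y * W (suc v) m ν θ ≈ Y * W′ v m ν θ + X * W′ (suc v) m ν θ

    VV-comm [] [] 0<c = refl
    VV-comm {m = suc m} {ν = v ∷ ν} {l ∷ θ} (v≤N ∷ p) (l≤M ∷ q) v<c with ℕₚ.<-cmp l v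
    ... | tri< l<v _ _ = trans (VV-low a b a' b' m ν θ (ℕₚ.<⇒≤ v<c) (ℕₚ.<⇒≤ l<v)) (trans (*-zero-middle (u-< a' b' l<v))
                          (sym (trans (VV-low a' b' a b m ν θ (ℕₚ.<⇒≤ v<c) (ℕₚ.<⇒≤ l<v)) (*-zero-middle (u-< a b l<v)))))
    ... | tri≈ _ ≡.refl _ = begin
        _ ≈⟨ VV-low a b a' b' m ν θ v≤c ℕₚ.≤-refl ⟩
        a * (u a' b' v v * W v m ν θ) ≈⟨ *-congˡ (*-cong (u-diag a' b' v) (VV-comm-low p q)) ⟩
        a * (a' * W′ v m ν θ) ≈⟨ *-leftComm _ _ _ ⟩
        a' * (a * W′ v m ν θ) ≈⟨ *-congˡ (*-congʳ (u-diag a b v)) ⟨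
        _ ≈⟨ VV-low a' b' a b m ν θ v≤c ℕₚ.≤-refl ⟨
        _ ∎
      where v≤c = ℕₚ.<⇒≤ v<c
    ... | tri> _ _ v<l with ℕₚ.<-cmp l (suc v)
    ...   | tri< l<1+v _ _ = contradiction v<l (ℕₚ.≤⇒≯ (ℕₚ.≤-pred l<1+v))
    ...   | tri≈ _ ≡.refl _ = begin
        _ ≈⟨ VV-suc a b a' b' m v ν θ v<c ⟩
        X * W v m ν θ + Y * W (suc v) m ν θ ≈⟨ VV-comm-step p q ⟩
        Y * W′ v m ν θ + X * W′ (suc v) m ν θ ≈⟨ +-cong (*-congʳ (*-comm _ _)) (*-congʳ (*-comm _ _)) ⟩
        _ ≈⟨ VV-suc a' b' a b m v ν θ v<c ⟨
        _ ∎
    ...   | tri> _ _ 1+v<l = begin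
        _ ≈⟨ VV-full a b a' b' m l ν θ v<c ⟩
        a * (u a' b' v l * W v m ν θ) + b * (u a' b' (suc v) l * W (suc v) m ν θ)
          ≈⟨ +-cong (trans (*-zero-middle (u-≫ a' b' 1+v<l)) (sym (*-zero-middle (u-≫ a b 1+v<l)))) high ⟩
        _ ≈⟨ VV-full a' b' a b m l ν θ v<c ⟨
        _ ∎
      where
      high : b * (u a' b' (suc v) l * W (suc v) m ν θ) ≈ b' * (u a b (suc v) l * W′ (suc v) m ν θ)
      high with ℕₚ.<-cmp l (suc (suc v))
      ... | tri< l<2+v _ _ = contradiction 1+v<l (ℕₚ.≤⇒≯ (ℕₚ.≤-pred l<2+v))
      ... | tri≈ _ ≡.refl _ = begin
        _ ≈⟨ *-congˡ (*-cong (u-suc a' b' (suc v)) (VV-comm p q (s≤s (head-≤ p)))) ⟩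
        b * (b' * W′ (suc v) m ν θ) ≈⟨ *-leftComm _ _ _ ⟩
        b' * (b * W′ (suc v) m ν θ) ≈⟨ *-congˡ (*-congʳ (u-suc a b (suc v))) ⟨
        _ ∎
      ... | tri> _ _ 2+v<l = trans (*-zero-middle (u-≫ a' b' 2+v<l)) (sym (*-zero-middle (u-≫ a b 2+v<l)))

    VV-comm-low [] [] = refl
    VV-comm-low {w} {suc m} {v ∷ ν} {l ∷ θ} (v≤w ∷ p) (l≤w ∷ q) with ℕₚ.<-cmp v w
    ... | tri< v<w _ _ = VV-comm (v≤w ∷ p) (l≤w ∷ q) v<w
    ... | tri> _ _ w<v = contradiction w<v (ℕₚ.≤⇒≯ v≤w)
    ... | tri≈ _ ≡.refl _ with ℕₚ.<-cmp l v
    ...   | tri< l<v _ _ = trans (VV-low a b a' b' m ν θ ℕₚ.≤-refl (ℕₚ.<⇒≤ l<v)) (trans (*-zero-middle (u-< a' b' l<v))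
                          (sym (trans (VV-low a' b' a b m ν θ ℕₚ.≤-refl (ℕₚ.<⇒≤ l<v)) (*-zero-middle (u-< a b l<v)))))
    ...   | tri> _ _ v<l = contradiction v<l (ℕₚ.≤⇒≯ l≤w)
    ...   | tri≈ _ ≡.refl _ = begin
        _ ≈⟨ VV-low a b a' b' m ν θ ℕₚ.≤-refl ℕₚ.≤-refl ⟩
        a * (u a' b' v v * W v m ν θ) ≈⟨ *-congˡ (*-cong (u-diag a' b' v) (VV-comm-low p q)) ⟩
        a * (a' * W′ v m ν θ) ≈⟨ *-leftComm _ _ _ ⟩
        a' * (a * W′ v m ν θ) ≈⟨ *-congˡ (*-congʳ (u-diag a b v)) ⟨
        _ ≈⟨ VV-low a' b' a b m ν θ ℕₚ.≤-refl ℕₚ.≤-refl ⟨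
        _ ∎

    VV-comm-step [] [] = +-comm _ _
    VV-comm-step {w} {suc m} {v ∷ ν} {l ∷ θ} (v≤w ∷ p) (l≤1+w ∷ q) with ℕₚ.<-cmp v w
    ... | tri> _ _ w<v = contradiction w<v (ℕₚ.≤⇒≯ v≤w)
    -- Both `w` and `suc w` exceed the row `v`, so neither ceiling binds, the two sums are equal and
    -- their coefficients can trade places.
    ... | tri< v<w _ _ = begin
        X * W w (suc m) (v ∷ ν) (l ∷ θ) + Y * W (suc w) (suc m) (v ∷ ν) (l ∷ θ) ≈⟨ +-comm _ _ ⟩
        Y * W (suc w) (suc m) (v ∷ ν) (l ∷ θ) + X * W w (suc m) (v ∷ ν) (l ∷ θ)
          ≈⟨ +-cong (*-congˡ (trans (VV-full a b a' b' m l ν θ v<1+w) (sym (VV-full a b a' b' m l ν θ v<w))))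
                    (*-congˡ (trans (VV-full a b a' b' m l ν θ v<w) (sym (VV-full a b a' b' m l ν θ v<1+w)))) ⟩
        Y * W w (suc m) (v ∷ ν) (l ∷ θ) + X * W (suc w) (suc m) (v ∷ ν) (l ∷ θ) ≈⟨ +-cong (*-congˡ (VV-comm (v≤w ∷ p) (l≤1+w ∷ q) v<w)) (*-congˡ (VV-comm (v≤w ∷ p) (l≤1+w ∷ q) v<1+w)) ⟩
        Y * W′ w (suc m) (v ∷ ν) (l ∷ θ) + X * W′ (suc w) (suc m) (v ∷ ν) (l ∷ θ) ∎
      where
      v<1+w = ℕₚ.m<n⇒m<1+n v<w
    ... | tri≈ _ ≡.refl _ with ℕₚ.<-cmp l (suc v)
    ...   | tri> _ _ 1+v<l = contradiction 1+v<l (ℕₚ.≤⇒≯ l≤1+w)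
    ...   | tri< (s≤s l≤v) _ _ = begin
        X * W v (suc m) (v ∷ ν) (l ∷ θ) + Y * W (suc v) (suc m) (v ∷ ν) (l ∷ θ) ≈⟨ +-comm _ _ ⟩
        Y * W (suc v) (suc m) (v ∷ ν) (l ∷ θ) + X * W v (suc m) (v ∷ ν) (l ∷ θ)
          ≈⟨ +-cong (*-congˡ (trans (VV-low a b a' b' m ν θ (ℕₚ.n≤1+n v) l≤v) (sym (VV-low a b a' b' m ν θ ℕₚ.≤-refl l≤v))))
                    (*-congˡ (trans (VV-low a b a' b' m ν θ ℕₚ.≤-refl l≤v) (sym (VV-low a b a' b' m ν θ (ℕₚ.n≤1+n v) l≤v)))) ⟩
        Y * W v (suc m) (v ∷ ν) (l ∷ θ) + X * W (suc v) (suc m) (v ∷ ν) (l ∷ θ) ≈⟨ +-cong (*-congˡ (VV-comm-low (v≤w ∷ p) (l≤v ∷ q))) (*-congˡ (VV-comm (v≤w ∷ p) (l≤v ∷ q) ℕₚ.≤-refl)) ⟩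
        Y * W′ v (suc m) (v ∷ ν) (l ∷ θ) + X * W′ (suc v) (suc m) (v ∷ ν) (l ∷ θ) ∎
    ...   | tri≈ _ ≡.refl _ = begin
        X * W v (suc m) (v ∷ ν) (suc v ∷ θ) + Y * W (suc v) (suc m) (v ∷ ν) (suc v ∷ θ)
          ≈⟨ +-cong (*-congˡ (VV-suc-tight a b a' b' m v ν θ)) (*-congˡ (VV-suc a b a' b' m v ν θ ℕₚ.≤-refl)) ⟩
        -- The induction hypothesis `step` is spent twice, in the `Y` term and then in the `X` term.
        -- In between, `f′` becomes `f` by `VV-comm`, because the rows of `ν` stay below the ceiling
        -- `suc v`.
        X * (X * g) + Y * (X * g + Y * f)   ≈⟨ +-congˡ (*-congˡ step) ⟩
        X * (X * g) + Y * (Y * g′ + X * f′) ≈⟨ solve 5 (λ x y g g′ f′ → x :* (x :* g) :+ y :* (y :* g′ :+ x :* f′) := y :* (y :* g′) :+ x :* (x :* g :+ y :* f′)) refl X Y g g′ f′ ⟩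
        Y * (Y * g′) + X * (X * g + Y * f′) ≈⟨ +-congˡ (*-congˡ (+-congˡ (*-congˡ (sym (VV-comm p q (s≤s (head-≤ p))))))) ⟩
        Y * (Y * g′) + X * (X * g + Y * f)  ≈⟨ +-congˡ (*-congˡ step) ⟩
        Y * (Y * g′) + X * (Y * g′ + X * f′)
          ≈⟨ +-cong (*-congˡ (trans (VV-suc-tight a' b' a b m v ν θ) (*-congʳ (*-comm a' b))))
                    (*-congˡ (trans (VV-suc a' b' a b m v ν θ ℕₚ.≤-refl) (+-cong (*-congʳ (*-comm a' b)) (*-congʳ (*-comm b' a))))) ⟨
        _ ∎
      where
      g = W v m ν θ
      f = W (suc v) m ν θ
      g′ = W′ v m ν θ
      f′ = W′ (suc v) m ν θ
      step : X * g + Y * f ≈ Y * g′ + X * f′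
      step = VV-comm-step p q

  -- Branching of Schur polynomials

  ∑-rows-suc : ∀ (vs : List A) l (f : List A → Carrier) →
               ∑ (rowsFrom vs (suc l)) f ≈ ∑ vs (λ a → ∑ (rowsFrom vs l) (λ row → f (a ∷ row)))
  ∑-rows-suc vs l f = ∑-concatMap-map vs (λ _ → rowsFrom vs l) _∷_ f

  rowsFrom-All : ∀ {P : A → Set} {vs} → All P vs → ∀ l → All (λ row → All P row × length row ≡ l) (rowsFrom vs l)
  rowsFrom-All ps zero    = ([] , ≡.refl) ∷ []
  rowsFrom-All ps (suc l) = Allₚ.concat⁺ (Allₚ.map⁺ (All.map
    (λ p → Allₚ.map⁺ (All.map (λ (q , e) → p ∷ q , ≡.cong suc e) (rowsFrom-All ps l))) ps))

  rowsFrom-length : ∀ (vs : List A) l → All (λ row → length row ≡ l) (rowsFrom vs l)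
  rowsFrom-length vs l = All.map proj₂ (rowsFrom-All (All.universal-U vs) l)

  allFin-∷ʳ : ∀ n → allFin (suc n) ≡ map inject₁ (allFin n) ∷ʳ fromℕ n
  allFin-∷ʳ n = ≡.trans (tabulate-∷ʳ n id) (≡.cong (_∷ʳ fromℕ n) (≡.sym (Listₚ.map-tabulate id inject₁)))
    where
    tabulate-∷ʳ : ∀ n (f : Fin (suc n) → A) → tabulate f ≡ tabulate (f ∘ inject₁) ∷ʳ f (fromℕ n)
    tabulate-∷ʳ zero    f = ≡.refl
    tabulate-∷ʳ (suc n) f = ≡.cong (f zero ∷_) (tabulate-∷ʳ n (f ∘ suc))

  ∑-allFin : ∀ n (f : Fin (suc n) → Carrier) → ∑ (allFin (suc n)) f ≈ ∑ (allFin n) (f ∘ inject₁) + f (fromℕ n)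
  ∑-allFin n f = begin
    _ ≈⟨ reflexive (≡.cong (λ xs → ∑ xs f) (allFin-∷ʳ n)) ⟩
    _ ≈⟨ ∑-++ (map inject₁ (allFin n)) _ f ⟩
    _ ≈⟨ +-cong (∑-map (allFin n) inject₁ f) (+-identityʳ _) ⟩
    _ ∎

  monomial : ∀ {n} → (Fin n → Carrier) → List (Fin n) → Carrier
  monomial x row = prodR R (map x row)

  monomial-++ : ∀ {n} (x : Fin n → Carrier) xs ys → monomial x (xs ++ ys) ≈ monomial x xs * monomial x ys
  monomial-++ x []       ys = sym (*-identityˡ _)
  monomial-++ x (a ∷ xs) ys = trans (*-congˡ (monomial-++ x xs ys)) (sym (*-assoc _ _ _))

  -- The generating function of the tableaux of shape  θ  that can be placed below the row  prev.
  tableaux : ∀ {n} → (Fin n → Carrier) → List (Fin n) → List ℕ → Carrier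
  tableaux x prev []      = 1#
  tableaux {n} x prev (l ∷ θ) = ∑ (rowsFrom (allFin n) l) (λ row →
    ⟦ weaklyIncr row ⟧ * (⟦ belowGreater row prev ⟧ * (monomial x row * tableaux x row θ)))

  belowGreater-[] : ∀ {n} (row : List (Fin n)) → belowGreater row [] ≡ true
  belowGreater-[] []      = ≡.refl
  belowGreater-[] (_ ∷ _) = ≡.refl

  schur-tableaux : ∀ {n} (x : Fin n → Carrier) θ → schur R x θ ≈ tableaux x [] θ
  schur-tableaux {n} x θ = begin
    _ ≈⟨ ∑-filter (choices (map (rowsFrom (allFin n)) θ)) isSSYT _ ⟩
    _ ≈⟨ ∑-cong (choices (map (rowsFrom (allFin n)) θ)) (λ T → *-congʳ (reflexive (≡.cong (λ p → ⟦ rowsOK T ∧ p ⟧) (≡.sym (below-[] T))))) ⟩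
    _ ≈⟨ below θ [] ⟩
    _ ∎
    where
    rowsOK : List (List (Fin n)) → Bool
    rowsOK = foldr (λ r b → weaklyIncr r ∧ b) true
    below-[] : ∀ T → colsStrictlyIncr {n} ([] ∷ T) ≡ colsStrictlyIncr T
    below-[] []      = ≡.refl
    below-[] (r ∷ T) = ≡.cong (_∧ colsStrictlyIncr (r ∷ T)) (belowGreater-[] r)
    below : ∀ θ prev → ∑ (choices (map (rowsFrom (allFin n)) θ)) (λ T → ⟦ rowsOK T ∧ colsStrictlyIncr (prev ∷ T) ⟧ * monomial x (concat T))
                     ≈ tableaux x prev θ
    below []      prev = trans (+-identityʳ _) (*-identityˡ _)
    below (l ∷ θ) prev = begin
      _ ≈⟨ ∑-concatMap-map (rowsFrom (allFin n) l) (λ _ → choices (map (rowsFrom (allFin n)) θ)) _∷_ _ ⟩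
      _ ≈⟨ ∑-cong (rowsFrom (allFin n) l) (λ row → begin
             _ ≈⟨ ∑-cong (choices (map (rowsFrom (allFin n)) θ)) (λ T → begin
                    _ ≈⟨ *-cong (⟦∧∧⟧ (weaklyIncr row) (rowsOK T) (belowGreater row prev) (colsStrictlyIncr (row ∷ T))) (monomial-++ x row (concat T)) ⟩
                    _ ≈⟨ solve 6 (λ a b c d e f → ((a :* b) :* (c :* d)) :* (e :* f) := (a :* (c :* e)) :* ((b :* d) :* f)) refl
                           ⟦ weaklyIncr row ⟧ ⟦ rowsOK T ⟧ ⟦ belowGreater row prev ⟧ ⟦ colsStrictlyIncr (row ∷ T) ⟧ (monomial x row) (monomial x (concat T)) ⟩
                    _ ≈⟨ *-congˡ (*-congʳ (⟦∧⟧ (rowsOK T) _)) ⟨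
                    (⟦ weaklyIncr row ⟧ * (⟦ belowGreater row prev ⟧ * monomial x row)) * (⟦ rowsOK T ∧ colsStrictlyIncr (row ∷ T) ⟧ * monomial x (concat T)) ∎) ⟩
             _ ≈⟨ ∑-*ˡ (choices (map (rowsFrom (allFin n)) θ)) _ _ ⟩
             _ ≈⟨ *-congˡ (below θ row) ⟩
             _ ≈⟨ solve 4 (λ a b c d → (a :* (b :* c)) :* d := a :* (b :* (c :* d))) refl ⟦ weaklyIncr row ⟧ ⟦ belowGreater row prev ⟧ (monomial x row) _ ⟩
             _ ∎) ⟩
      _ ∎

  tableaux-∷ʳ0 : ∀ {n} (x : Fin n → Carrier) prev θ → tableaux x prev (θ ∷ʳ 0) ≈ tableaux x prev θ
  tableaux-∷ʳ0 x prev []      = solve 0 (con 1 :* (con 1 :* (con 1 :* con 1)) :+ con 0 := con 1) refl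
  tableaux-∷ʳ0 {n} x prev (l ∷ θ) = ∑-cong (rowsFrom (allFin n) l) (λ row → *-congˡ (*-congˡ (*-congˡ (tableaux-∷ʳ0 x row θ))))

  headAbove : ∀ {n} → Fin n → List (Fin n) → Bool
  headAbove a []      = true
  headAbove a (b ∷ _) = toℕ a ≤ᵇ toℕ b

  weaklyIncr-∷ : ∀ {n} (a : Fin n) row → weaklyIncr (a ∷ row) ≡ headAbove a row ∧ weaklyIncr row
  weaklyIncr-∷ a []        = ≡.refl
  weaklyIncr-∷ a (b ∷ row) = ≡.refl

  ⟦weaklyIncr-∷⟧ : ∀ {n} (a : Fin n) row {z} → ⟦ weaklyIncr (a ∷ row) ⟧ * z ≈ ⟦ weaklyIncr row ⟧ * (⟦ headAbove a row ⟧ * z)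
  ⟦weaklyIncr-∷⟧ a row {z} = begin
    _ ≈⟨ *-congʳ (reflexive (≡.cong ⟦_⟧ (weaklyIncr-∷ a row))) ⟩
    _ ≈⟨ *-congʳ (⟦∧⟧ (headAbove a row) (weaklyIncr row)) ⟩
    _ ≈⟨ solve 3 (λ a b c → (a :* b) :* c := b :* (a :* c)) refl ⟦ headAbove a row ⟧ ⟦ weaklyIncr row ⟧ z ⟩
    _ ∎

  module _ {n : ℕ} where

    extend : ℕ → List (Fin n) → List (Fin (suc n))
    extend j row = map inject₁ row ++ replicate j (fromℕ n)

    headAbove-inject₁ : ∀ a j row → ⟦ headAbove (inject₁ a) (extend j row) ⟧ ≈ ⟦ headAbove a row ⟧
    headAbove-inject₁ a zero    []      = refl
    headAbove-inject₁ a (suc j) []      = trans (⟦≤ᵇ⟧ (toℕ (inject₁ a)) (toℕ (fromℕ n)))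
      (le-≤ (≡.subst (_≤ toℕ (fromℕ n)) (≡.sym (Finₚ.toℕ-inject₁ a)) (≡.subst (toℕ a ≤_) (≡.sym (Finₚ.toℕ-fromℕ n)) (ℕₚ.<⇒≤ (Finₚ.toℕ<n a)))))
    headAbove-inject₁ a j       (b ∷ _) = reflexive (≡.cong ⟦_⟧ (≡.cong₂ _≤ᵇ_ (Finₚ.toℕ-inject₁ a) (Finₚ.toℕ-inject₁ b)))

    headAbove-fromℕ : ∀ j → ⟦ headAbove (fromℕ n) (extend j []) ⟧ ≈ 1#
    headAbove-fromℕ zero    = refl
    headAbove-fromℕ (suc j) = trans (⟦≤ᵇ⟧ (toℕ (fromℕ n)) (toℕ (fromℕ n))) (le-≤ {toℕ (fromℕ n)} ℕₚ.≤-refl)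

    headAbove-fromℕ-∷ : ∀ b row → ⟦ headAbove (fromℕ n) (inject₁ b ∷ row) ⟧ ≈ 0#
    headAbove-fromℕ-∷ b row = trans (⟦≤ᵇ⟧ (toℕ (fromℕ n)) (toℕ (inject₁ b)))
      (le-> (≡.subst₂ _<_ (≡.sym (Finₚ.toℕ-inject₁ b)) (≡.sym (Finₚ.toℕ-fromℕ n)) (Finₚ.toℕ<n b)))

    -- In a weakly increasing row the copies of the largest letter stand at the end, after an
    -- arbitrary weakly increasing row in the other letters.
    ∑-weaklyIncr : ∀ l (f : List (Fin (suc n)) → Carrier) →
      ∑ (rowsFrom (allFin (suc n)) l) (λ row → ⟦ weaklyIncr row ⟧ * f row)
      ≈ ∑ (zeroTo l) (λ k → ∑ (rowsFrom (allFin n) k) (λ row → ⟦ weaklyIncr row ⟧ * f (extend (l ∸ k) row)))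
    ∑-weaklyIncr zero    f = sym (+-identityʳ _)
    ∑-weaklyIncr (suc l) f = begin
      _ ≈⟨ ∑-rows-suc (allFin (suc n)) l _ ⟩
      ∑ (allFin (suc n)) G ≈⟨ ∑-allFin n G ⟩
      ∑ (allFin n) (G ∘ inject₁) + G (fromℕ n) ≈⟨ +-cong (trans (∑-cong (allFin n) small) swapped) large ⟩
      ∑ (zeroTo l) (λ k → ∑ (rowsFrom (allFin n) (suc k)) (λ row → ⟦ weaklyIncr row ⟧ * f (extend (l ∸ k) row)))
        + ∑ (rowsFrom (allFin n) 0) (λ row → ⟦ weaklyIncr row ⟧ * f (extend (suc l) row)) ≈⟨ +-comm _ _ ⟩
      _ ≈⟨ ∑≤-suc l _ ⟨
      _ ∎
      where
      G = λ a → ∑ (rowsFrom (allFin (suc n)) l) (λ row → ⟦ weaklyIncr (a ∷ row) ⟧ * f (a ∷ row))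
      G′ = λ a k row → ⟦ weaklyIncr row ⟧ * (⟦ headAbove a (extend (l ∸ k) row) ⟧ * f (a ∷ extend (l ∸ k) row))
      expand : ∀ a → G a ≈ ∑ (zeroTo l) (λ k → ∑ (rowsFrom (allFin n) k) (G′ a k))
      expand a = trans (∑-cong (rowsFrom (allFin (suc n)) l) (λ row → ⟦weaklyIncr-∷⟧ a row))
                       (∑-weaklyIncr l (λ row → ⟦ headAbove a row ⟧ * f (a ∷ row)))
      small : ∀ a → G (inject₁ a) ≈ ∑ (zeroTo l) (λ k → ∑ (rowsFrom (allFin n) k) (λ row → ⟦ weaklyIncr (a ∷ row) ⟧ * f (extend (l ∸ k) (a ∷ row))))
      small a = trans (expand (inject₁ a)) (∑-cong (zeroTo l) (λ k → ∑-cong (rowsFrom (allFin n) k) (λ row →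
        trans (*-congˡ (*-congʳ (headAbove-inject₁ a (l ∸ k) row))) (sym (⟦weaklyIncr-∷⟧ a row)))))
      swapped : ∑ (allFin n) (λ a → ∑ (zeroTo l) (λ k → ∑ (rowsFrom (allFin n) k) (λ row → ⟦ weaklyIncr (a ∷ row) ⟧ * f (extend (l ∸ k) (a ∷ row)))))
              ≈ ∑ (zeroTo l) (λ k → ∑ (rowsFrom (allFin n) (suc k)) (λ row → ⟦ weaklyIncr row ⟧ * f (extend (l ∸ k) row)))
      swapped = trans (∑-swap (allFin n) (zeroTo l) _) (∑-cong (zeroTo l) (λ k → sym (∑-rows-suc (allFin n) k _)))
      first : ∑ (rowsFrom (allFin n) 0) (G′ (fromℕ n) 0) ≈ ∑ (rowsFrom (allFin n) 0) (λ row → ⟦ weaklyIncr row ⟧ * f (extend (suc l) row))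
      first = +-congʳ (*-congˡ (trans (*-congʳ (headAbove-fromℕ l)) (*-identityˡ _)))
      rest : ∀ k → ∑ (rowsFrom (allFin n) (suc k)) (G′ (fromℕ n) (suc k)) ≈ 0#
      rest k = trans (∑-rows-suc (allFin n) k _) (∑-zero (allFin n) (λ b → ∑-zero (rowsFrom (allFin n) k) (λ row →
        *-zero-middle (headAbove-fromℕ-∷ b (extend (l ∸ suc k) row)))))
      only-first : ∀ N → ∑ (zeroTo N) (λ k → ∑ (rowsFrom (allFin n) k) (G′ (fromℕ n) k)) ≈ ∑ (rowsFrom (allFin n) 0) (G′ (fromℕ n) 0)
      only-first zero    = +-identityʳ _
      only-first (suc N) = trans (∑≤-suc N _) (trans (+-congˡ (∑-zero (zeroTo N) rest)) (+-identityʳ _))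
      large : G (fromℕ n) ≈ ∑ (rowsFrom (allFin n) 0) (λ row → ⟦ weaklyIncr row ⟧ * f (extend (suc l) row))
      large = trans (expand (fromℕ n)) (trans (only-first l) first)

    -- Nothing can stand under a copy of the largest letter, so the whole lower row must fit under
    -- the smaller entries of `prev`. This is the horizontal strip condition. Under a smaller entry
    -- the largest letter is always allowed.
    belowGreater-extend : ∀ i row j prev → length row ℕ.+ i ≤ length prev ℕ.+ j →
      ⟦ belowGreater (extend i row) (extend j prev) ⟧ ≈ le (length row ℕ.+ i) (length prev) * ⟦ belowGreater row prev ⟧
    belowGreater-extend zero    []        j       prev       _       = sym (*-identityˡ _)
    belowGreater-extend (suc i) []        (suc j) []         _       = trans (⟦∧⟧ (toℕ (fromℕ n) <ᵇ toℕ (fromℕ n)) _)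
      (trans (*-zeroˡ (trans (⟦≤ᵇ⟧ (suc (toℕ (fromℕ n))) (toℕ (fromℕ n))) (le-> {suc (toℕ (fromℕ n))} ℕₚ.≤-refl))) (sym (zeroˡ _)))
    belowGreater-extend (suc i) []        j       (a ∷ prev) (s≤s p) = begin
      _ ≈⟨ ⟦∧⟧ (toℕ (inject₁ a) <ᵇ toℕ (fromℕ n)) _ ⟩
      _ ≈⟨ *-cong (trans (⟦≤ᵇ⟧ (suc (toℕ (inject₁ a))) (toℕ (fromℕ n))) (le-≤ (≡.subst₂ _<_ (≡.sym (Finₚ.toℕ-inject₁ a)) (≡.sym (Finₚ.toℕ-fromℕ n)) (Finₚ.toℕ<n a))))
                  (belowGreater-extend i [] j prev p) ⟩
      _ ≈⟨ *-identityˡ _ ⟩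
      _ ∎
    belowGreater-extend i       (b ∷ row) (suc j) []         _       = trans (⟦∧⟧ (toℕ (fromℕ n) <ᵇ toℕ (inject₁ b)) _)
      (trans (*-zeroˡ (trans (⟦≤ᵇ⟧ (suc (toℕ (fromℕ n))) (toℕ (inject₁ b)))
        (le-> (s≤s (≡.subst₂ _≤_ (≡.sym (Finₚ.toℕ-inject₁ b)) (≡.sym (Finₚ.toℕ-fromℕ n)) (ℕₚ.<⇒≤ (Finₚ.toℕ<n b))))))) (sym (zeroˡ _)))
    belowGreater-extend i       (b ∷ row) j       (a ∷ prev) (s≤s p) = begin
      _ ≈⟨ ⟦∧⟧ (toℕ (inject₁ a) <ᵇ toℕ (inject₁ b)) _ ⟩
      _ ≈⟨ *-cong (reflexive (≡.cong ⟦_⟧ (≡.cong₂ _<ᵇ_ (Finₚ.toℕ-inject₁ a) (Finₚ.toℕ-inject₁ b)))) (belowGreater-extend i row j prev p) ⟩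
      _ ≈⟨ *-leftComm _ _ _ ⟩
      _ ≈⟨ *-congˡ (⟦∧⟧ (toℕ a <ᵇ toℕ b) _) ⟨
      _ ∎

    module _ (x : Fin (suc n) → Carrier) where
      private
        x′ = x ∘ inject₁
        t = x (fromℕ n)

      monomial-extend : ∀ j row → monomial x (extend j row) ≈ monomial x′ row * h t j 0
      monomial-extend zero    []        = sym (*-identityʳ _)
      monomial-extend (suc j) []        = trans (*-congˡ (trans (monomial-extend j []) (*-identityˡ _))) (sym (*-identityˡ _))
      monomial-extend j       (a ∷ row) = trans (*-congˡ (monomial-extend j row)) (sym (*-assoc _ _ _))

      -- Common to the first row, which has nothing above it, and to later rows, which lie below an
      -- extended row. The two cases differ in the ceiling `c` and in the proof of `column`.
      tableaux-branch-∷ : ∀ c m l θ prev prev′ →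
        (∀ i row → length row ℕ.+ i ≡ l → ⟦ belowGreater (extend i row) prev ⟧ ≈ le l c * ⟦ belowGreater row prev′ ⟧) →
        (∀ i row → length row ℕ.+ i ≡ l →
          tableaux x (extend i row) θ ≈ ∑ (parts (length row) m) (λ κ → H t 0 (length row) θ κ * tableaux x′ row κ)) →
        tableaux x prev (l ∷ θ) ≈ ∑ (parts c (suc m)) (λ κ → H t 0 c (l ∷ θ) κ * tableaux x′ prev′ κ)
      tableaux-branch-∷ c m l θ prev prev′ column branch = begin
        _ ≈⟨ ∑-weaklyIncr l _ ⟩
        _ ≈⟨ ∑-congAll (All.map byLength (zeroTo-≤ l)) ⟩
        ∑ (zeroTo l) (λ k → le l c * (h t (l ∸ k) 0 * Z k)) ≈⟨ ∑-*ˡ (zeroTo l) _ _ ⟩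
        le l c * ∑ (zeroTo l) (λ k → h t (l ∸ k) 0 * Z k) ≈⟨ range ⟩
        le l c * ∑ (zeroTo c) (λ k → h t l k * Z k) ≈⟨ ∑-*ˡ (zeroTo c) _ _ ⟨
        ∑ (zeroTo c) (λ k → le l c * (h t l k * Z k)) ≈⟨ ∑-cong (zeroTo c) collect ⟨
        _ ≈⟨ ∑P-suc c m _ ⟨
        _ ∎
        where
        w = λ row → ⟦ weaklyIncr row ⟧ * (⟦ belowGreater row prev′ ⟧ * monomial x′ row)
        Z = λ k → ∑ (rowsFrom (allFin n) k) (λ row → w row * ∑ (parts k m) (λ κ → H t 0 k θ κ * tableaux x′ row κ))
        byLength : ∀ {k} → k ≤ l → ∑ (rowsFrom (allFin n) k) (λ row → ⟦ weaklyIncr row ⟧ * (⟦ belowGreater (extend (l ∸ k) row) prev ⟧ *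
                     (monomial x (extend (l ∸ k) row) * tableaux x (extend (l ∸ k) row) θ))) ≈ le l c * (h t (l ∸ k) 0 * Z k)
        byLength {k} k≤l = begin
          _ ≈⟨ ∑-congAll (All.map (λ {row} e → byRow row e) (rowsFrom-length (allFin n) k)) ⟩
          _ ≈⟨ ∑-*ˡ (rowsFrom (allFin n) k) _ _ ⟩
          (le l c * h t (l ∸ k) 0) * Z k ≈⟨ *-assoc _ _ _ ⟩
          _ ∎
          where
          byRow : ∀ row → length row ≡ k → ⟦ weaklyIncr row ⟧ * (⟦ belowGreater (extend (l ∸ k) row) prev ⟧ *
                     (monomial x (extend (l ∸ k) row) * tableaux x (extend (l ∸ k) row) θ))
                  ≈ (le l c * h t (l ∸ k) 0) * (w row * ∑ (parts k m) (λ κ → H t 0 k θ κ * tableaux x′ row κ))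
          byRow row ≡.refl = begin
            _ ≈⟨ *-congˡ (*-cong (column (l ∸ k) row e) (*-cong (monomial-extend (l ∸ k) row) (branch (l ∸ k) row e))) ⟩
            _ ≈⟨ solve 6 (λ a b c d e f → a :* ((b :* c) :* ((d :* e) :* f)) := (b :* e) :* ((a :* (c :* d)) :* f)) refl
                   ⟦ weaklyIncr row ⟧ (le l c) ⟦ belowGreater row prev′ ⟧ (monomial x′ row) (h t (l ∸ k) 0) _ ⟩
            _ ∎
            where e = ℕₚ.m+[n∸m]≡n k≤l
        range : le l c * ∑ (zeroTo l) (λ k → h t (l ∸ k) 0 * Z k) ≈ le l c * ∑ (zeroTo c) (λ k → h t l k * Z k)
        range with l ℕ.≤? c
        ... | no l≰c  = trans (*-zeroˡ (le-> (ℕₚ.≰⇒> l≰c))) (sym (*-zeroˡ (le-> (ℕₚ.≰⇒> l≰c))))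
        ... | yes l≤c = *-congˡ (begin
          _ ≈⟨ ∑-congAll (All.map (λ k≤l → trans (*-congʳ (le-≤ (ℕₚ.≤-trans k≤l l≤c))) (*-identityˡ _)) (zeroTo-≤ l)) ⟨
          ∑ (zeroTo l) (λ k → le k c * (h t (l ∸ k) 0 * Z k)) ≈⟨ ∑≤-exchange l c _ ⟩
          ∑ (zeroTo c) (λ k → le k l * (h t (l ∸ k) 0 * Z k)) ≈⟨ ∑-cong (zeroTo c) (λ k → trans (sym (*-assoc _ _ _)) (*-congʳ (sym (h-∸ t l k)))) ⟩
          _ ∎)
        collect : ∀ k → ∑ (parts k m) (λ κ → H t 0 c (l ∷ θ) (k ∷ κ) * tableaux x′ prev′ (k ∷ κ)) ≈ le l c * (h t l k * Z k)
        collect k = begin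
          _ ≈⟨ ∑-cong (parts k m) (λ κ → trans (solve 4 (λ a b c d → (a :* (b :* c)) :* d := (a :* b) :* (c :* d)) refl (le l c) (h t l k) (H t 0 k θ κ) _)
                 (*-congˡ (*-congˡ (∑-cong (rowsFrom (allFin n) k) (λ row → trans (*-congˡ (sym (*-assoc _ _ _))) (sym (*-assoc _ _ _))))))) ⟩
          _ ≈⟨ ∑-*ˡ (parts k m) _ _ ⟩
          (le l c * h t l k) * ∑ (parts k m) (λ κ → H t 0 k θ κ * ∑ (rowsFrom (allFin n) k) (λ row → w row * tableaux x′ row κ))
            ≈⟨ *-congˡ (∑-cong (parts k m) (λ κ → sym (∑-*ˡ (rowsFrom (allFin n) k) _ _))) ⟩
          _ ≈⟨ *-congˡ (∑-swap (parts k m) (rowsFrom (allFin n) k) _) ⟩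
          _ ≈⟨ *-congˡ (∑-cong (rowsFrom (allFin n) k) (λ row → trans (∑-cong (parts k m) (λ κ → *-leftComm _ _ _)) (∑-*ˡ (parts k m) _ _))) ⟩
          (le l c * h t l k) * Z k ≈⟨ *-assoc _ _ _ ⟩
          _ ∎

      tableaux-branch : ∀ {m θ} prev j → Part (length prev ℕ.+ j) m θ →
        tableaux x (extend j prev) θ ≈ ∑ (parts (length prev) m) (λ κ → H t 0 (length prev) θ κ * tableaux x′ prev κ)
      tableaux-branch prev j []        = sym (trans (+-identityʳ _) (*-identityˡ _))
      tableaux-branch {suc m} {l ∷ θ} prev j (l≤p ∷ p) = tableaux-branch-∷ (length prev) m l θ (extend j prev) prev
        (λ { i row ≡.refl → belowGreater-extend i row j prev l≤p })
        (λ { i row ≡.refl → tableaux-branch row i p })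

      schur-branch : ∀ {N m θ} → Part N m θ →
        tableaux x [] θ ≈ ∑ (parts N m) (λ κ → H t 0 N θ κ * tableaux x′ [] κ)
      schur-branch []        = sym (trans (+-identityʳ _) (*-identityˡ _))
      schur-branch {N} {suc m} {l ∷ θ} (l≤N ∷ p) = tableaux-branch-∷ N m l θ [] []
        (λ i row e → trans (reflexive (≡.cong ⟦_⟧ (≡.trans (belowGreater-[] (extend i row)) (≡.sym (belowGreater-[] row)))))
                           (sym (trans (*-congʳ (le-≤ l≤N)) (*-identityˡ _))))
        (λ { i row ≡.refl → tableaux-branch row i p })

  -- Reverse flagged fillings

  -- The number of ways to fill the shape  μ  below the row  prev, the first row using entries at most  k.
  fillings : ℕ → List ℕ → List ℕ → Carrier
  fillings k prev []      = 1#
  fillings k prev (l ∷ μ) = ∑ (rowsFrom (oneTo k) l) (λ row →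
    ⟦ strictlyDecr row ⟧ * (⟦ belowLeq row prev ⟧ * fillings (ℕ.pred k) row μ))

  rowChoices : ℕ → ℕ → List ℕ → List (List (List ℕ))
  rowChoices n i []       = []
  rowChoices n i (l ∷ ls) = rowsFrom (oneTo (n ∸ i)) l ∷ rowChoices n (suc i) ls

  -- The rows of a candidate filling are listed by a function local to  flaggedCands, which cannot
  -- be named here. Abstracting  suc i  and  l ∷ ls  leaves it applied to distinct variables,
  -- so that the underscore below is found by unification.
  mutual
    flaggedCands-choices : ∀ n i μ → flaggedCands n i μ ≡ choices (rowChoices n i μ)
    flaggedCands-choices n i [] = ≡.refl
    flaggedCands-choices n i (l ∷ ls) with suc i | l ∷ ls
    ... | j | μ = ≡.cong (λ ts → concatMap (λ a → map (a ∷_) ts) (rowsFrom (oneTo (n ∸ i)) l)) (localRows-choices n i μ j ls)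

    localRows-choices : ∀ n i μ j ls → _ ≡ choices (rowChoices n j ls)
    localRows-choices n i μ j []       = ≡.refl
    localRows-choices n i μ j (l ∷ ls) =
      ≡.cong (λ ts → concatMap (λ a → map (a ∷_) ts) (rowsFrom (oneTo (n ∸ j)) l)) (localRows-choices n i μ (suc j) ls)

  natR-length : ∀ (xs : List A) → natR R (length xs) ≈ ∑ xs (λ _ → 1#)
  natR-length []       = refl
  natR-length (x ∷ xs) = +-congˡ (natR-length xs)

  belowLeq-[] : ∀ row → belowLeq row [] ≡ true
  belowLeq-[] []      = ≡.refl
  belowLeq-[] (_ ∷ _) = ≡.refl

  r-fillings : ∀ n μ → natR R (r n μ) ≈ fillings (n ∸ 1) [] μ
  r-fillings n μ = begin
    _ ≈⟨ natR-length (filterᵇ isReverseFlaggedShapeOK (flaggedCands n 1 μ)) ⟩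
    _ ≈⟨ ∑-filter (flaggedCands n 1 μ) _ _ ⟩
    _ ≈⟨ reflexive (≡.cong (λ ts → ∑ ts (λ T → ⟦ isReverseFlaggedShapeOK T ⟧ * 1#)) (flaggedCands-choices n 1 μ)) ⟩
    _ ≈⟨ ∑-cong (choices (rowChoices n 1 μ)) (λ T → trans (*-identityʳ _) (reflexive (≡.cong (λ p → ⟦ rowsOK T ∧ p ⟧) (≡.sym (below-[] T))))) ⟩
    _ ≈⟨ below μ 1 [] ⟩
    _ ∎
    where
    rowsOK : List (List ℕ) → Bool
    rowsOK = foldr (λ r b → strictlyDecr r ∧ b) true
    below-[] : ∀ T → colsWeaklyDecr ([] ∷ T) ≡ colsWeaklyDecr T
    below-[] []      = ≡.refl
    below-[] (r ∷ T) = ≡.cong (_∧ colsWeaklyDecr (r ∷ T)) (belowLeq-[] r)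
    below : ∀ μ i prev → ∑ (choices (rowChoices n i μ)) (λ T → ⟦ rowsOK T ∧ colsWeaklyDecr (prev ∷ T) ⟧) ≈ fillings (n ∸ i) prev μ
    below []      i prev = +-identityʳ _
    below (l ∷ μ) i prev = begin
      _ ≈⟨ ∑-concatMap-map (rowsFrom (oneTo (n ∸ i)) l) (λ _ → choices (rowChoices n (suc i) μ)) _∷_ _ ⟩
      _ ≈⟨ ∑-cong (rowsFrom (oneTo (n ∸ i)) l) (λ row → begin
             _ ≈⟨ ∑-cong (choices (rowChoices n (suc i) μ)) (λ T → begin
                    _ ≈⟨ ⟦∧∧⟧ (strictlyDecr row) (rowsOK T) (belowLeq row prev) (colsWeaklyDecr (row ∷ T)) ⟩
                    _ ≈⟨ solve 4 (λ a b c d → (a :* b) :* (c :* d) := (a :* c) :* (b :* d)) refl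
                           ⟦ strictlyDecr row ⟧ ⟦ rowsOK T ⟧ ⟦ belowLeq row prev ⟧ ⟦ colsWeaklyDecr (row ∷ T) ⟧ ⟩
                    _ ≈⟨ *-congˡ (⟦∧⟧ (rowsOK T) _) ⟨
                    (⟦ strictlyDecr row ⟧ * ⟦ belowLeq row prev ⟧) * ⟦ rowsOK T ∧ colsWeaklyDecr (row ∷ T) ⟧ ∎) ⟩
             _ ≈⟨ ∑-*ˡ (choices (rowChoices n (suc i) μ)) _ _ ⟩
             _ ≈⟨ *-congˡ (below μ (suc i) row) ⟩
             _ ≈⟨ *-assoc _ _ _ ⟩
             _ ≈⟨ *-congˡ (*-congˡ (reflexive (≡.cong (λ k → fillings k row μ) (≡.sym (ℕₚ.pred[m∸n]≡m∸[1+n] n i))))) ⟩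
             _ ∎) ⟩
      _ ∎

  fillings-∷ʳ0 : ∀ k prev μ → fillings k prev (μ ∷ʳ 0) ≈ fillings k prev μ
  fillings-∷ʳ0 k prev []      = solve 0 (con 1 :* (con 1 :* con 1) :+ con 0 := con 1) refl
  fillings-∷ʳ0 k prev (l ∷ μ) = ∑-cong (rowsFrom (oneTo k) l) (λ row → *-congˡ (*-congˡ (fillings-∷ʳ0 (ℕ.pred k) row μ)))

  -- The flag drops by one per row and has reached 0 at the last row, which leaves no admissible
  -- entry.
  fillings-∷ʳsuc : ∀ prev μ v → fillings (length μ) prev (μ ∷ʳ suc v) ≈ 0#
  fillings-∷ʳsuc prev []      v = refl
  fillings-∷ʳsuc prev (l ∷ μ) v = ∑-zero (rowsFrom (oneTo (suc (length μ))) l) (λ row → *-zeroʳ (*-zeroʳ (fillings-∷ʳsuc row μ v)))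

  -- Deleting the entries 1 from a filling

  raise : ℕ → List ℕ → List ℕ
  raise j row = map suc row ++ replicate j 1

  headBelow : ℕ → List ℕ → Bool
  headBelow a []      = true
  headBelow a (b ∷ _) = b <ᵇ a

  ⟦strictlyDecr-∷⟧ : ∀ a row {z} → ⟦ strictlyDecr (a ∷ row) ⟧ * z ≈ ⟦ strictlyDecr row ⟧ * (⟦ headBelow a row ⟧ * z)
  ⟦strictlyDecr-∷⟧ a [] {z} = sym (*-congˡ (*-identityˡ z))
  ⟦strictlyDecr-∷⟧ a (b ∷ row) {z} = trans (*-congʳ (⟦∧⟧ (b <ᵇ a) (strictlyDecr (b ∷ row))))
    (solve 3 (λ a b c → (a :* b) :* c := b :* (a :* c)) refl ⟦ b <ᵇ a ⟧ ⟦ strictlyDecr (b ∷ row) ⟧ z)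

  headBelow-raise : ∀ {a} j row → 1 ≤ a → headBelow (suc a) (raise j row) ≡ headBelow a row
  headBelow-raise zero    []      _         = ≡.refl
  headBelow-raise (suc j) []      (s≤s z≤n) = ≡.refl
  headBelow-raise j       (b ∷ _) _         = ≡.refl

  oneTo-≥1 : ∀ k → All (1 ≤_) (oneTo k)
  oneTo-≥1 k = Allₚ.map⁺ (All.universal (λ _ → s≤s z≤n) (upTo k))

  ∑-oneTo : ∀ k (f : ℕ → Carrier) → ∑ (oneTo (suc k)) f ≈ f 1 + ∑ (oneTo k) (f ∘ suc)
  ∑-oneTo k f = trans (reflexive (≡.cong (λ xs → ∑ (map suc xs) f) (upTo-suc k))) (+-congˡ (∑-map (map suc (upTo k)) suc f))

  module _ (k : ℕ) where

    withoutOne withOne : ℕ → (List ℕ → Carrier) → Carrier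
    withoutOne l f    = ∑ (rowsFrom (oneTo k) l) (λ row → ⟦ strictlyDecr row ⟧ * f (raise 0 row))
    withOne zero    f = 0#
    withOne (suc l) f = ∑ (rowsFrom (oneTo k) l) (λ row → ⟦ strictlyDecr row ⟧ * f (raise 1 row))

    -- A strictly decreasing row of positive integers has at most one entry 1, and only at its end.
    -- Hence each row loses at most one box, which is the vertical strip condition.
    ∑-strictlyDecr : ∀ l (f : List ℕ → Carrier) →
      ∑ (rowsFrom (oneTo (suc k)) l) (λ row → ⟦ strictlyDecr row ⟧ * f row) ≈ withoutOne l f + withOne l f
    ∑-strictlyDecr zero    f = sym (+-identityʳ _)
    ∑-strictlyDecr (suc l) f = begin
      _ ≈⟨ ∑-rows-suc (oneTo (suc k)) l _ ⟩
      ∑ (oneTo (suc k)) G ≈⟨ ∑-oneTo k G ⟩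
      G 1 + ∑ (oneTo k) (G ∘ suc) ≈⟨ +-congˡ (trans (∑-cong (oneTo k) (λ a → expand (suc a))) (∑-+ (oneTo k) _ _)) ⟩
      G 1 + (∑ (oneTo k) (λ a → withoutOne l (f′ (suc a))) + ∑ (oneTo k) (λ a → withOne l (f′ (suc a))))
        ≈⟨ solve 3 (λ a b c → a :+ (b :+ c) := b :+ (a :+ c)) refl (G 1) _ _ ⟩
      ∑ (oneTo k) (λ a → withoutOne l (f′ (suc a))) + (G 1 + ∑ (oneTo k) (λ a → withOne l (f′ (suc a))))
        ≈⟨ +-cong (prepend 0 l) (trans (+-congʳ (expand 1)) (ones l)) ⟩
      _ ∎
      where
      f′ = λ a row → ⟦ headBelow a row ⟧ * f (a ∷ row)
      G = λ a → ∑ (rowsFrom (oneTo (suc k)) l) (λ row → ⟦ strictlyDecr (a ∷ row) ⟧ * f (a ∷ row))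
      expand : ∀ a → G a ≈ withoutOne l (f′ a) + withOne l (f′ a)
      expand a = trans (∑-cong (rowsFrom (oneTo (suc k)) l) (λ row → ⟦strictlyDecr-∷⟧ a row)) (∑-strictlyDecr l (f′ a))
      prepend : ∀ j l → ∑ (oneTo k) (λ a → ∑ (rowsFrom (oneTo k) l) (λ row → ⟦ strictlyDecr row ⟧ * f′ (suc a) (raise j row)))
                      ≈ ∑ (rowsFrom (oneTo k) (suc l)) (λ row → ⟦ strictlyDecr row ⟧ * f (raise j row))
      prepend j l = trans (∑-congAll (All.map (λ {a} 1≤a → ∑-cong (rowsFrom (oneTo k) l) (λ row →
        trans (*-congˡ (*-congʳ (reflexive (≡.cong ⟦_⟧ (headBelow-raise j row 1≤a))))) (sym (⟦strictlyDecr-∷⟧ a row)))) (oneTo-≥1 k)))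
        (sym (∑-rows-suc (oneTo k) l _))
      noOne : ∀ j l → ∑ (rowsFrom (oneTo k) (suc l)) (λ row → ⟦ strictlyDecr row ⟧ * f′ 1 (raise j row)) ≈ 0#
      noOne j l = trans (∑-rows-suc (oneTo k) l _) (∑-zero (oneTo k) (λ a → ∑-zero (rowsFrom (oneTo k) l) (λ row → *-zero-middle refl)))
      ones : ∀ l → (withoutOne l (f′ 1) + withOne l (f′ 1)) + ∑ (oneTo k) (λ a → withOne l (f′ (suc a))) ≈ withOne (suc l) f
      ones zero    = begin
        ((1# * (1# * f (1 ∷ [])) + 0#) + 0#) + ∑ (oneTo k) (λ a → 0#) ≈⟨ +-congˡ (∑-const0 (oneTo k)) ⟩
        ((1# * (1# * f (1 ∷ [])) + 0#) + 0#) + 0# ≈⟨ solve 1 (λ x → ((con 1 :* (con 1 :* x) :+ con 0) :+ con 0) :+ con 0 := con 1 :* x :+ con 0) refl (f (1 ∷ [])) ⟩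
        _ ∎
      ones (suc l) = begin
        _ ≈⟨ +-cong (+-cong (noOne 0 l) (tail l)) (prepend 1 l) ⟩
        (0# + 0#) + _ ≈⟨ +-congʳ (+-identityʳ _) ⟩
        0# + _ ≈⟨ +-identityˡ _ ⟩
        _ ∎
        where
        tail : ∀ l → withOne (suc l) (f′ 1) ≈ 0#
        tail zero    = trans (+-identityʳ _) (*-zero-middle refl)
        tail (suc l) = noOne 1 l

    ∑-strictlyDecr-u : ∀ l (f : List ℕ → Carrier) →
      ∑ (rowsFrom (oneTo (suc k)) l) (λ row → ⟦ strictlyDecr row ⟧ * f row)
      ≈ ∑ (zeroTo l) (λ v → u 1# 1# v l * ∑ (rowsFrom (oneTo k) v) (λ row → ⟦ strictlyDecr row ⟧ * f (raise (l ∸ v) row)))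
    ∑-strictlyDecr-u zero    f = trans (∑-strictlyDecr 0 f) (trans (+-identityʳ _) (sym (trans (+-identityʳ _) (*-identityˡ _))))
    ∑-strictlyDecr-u (suc l) f = begin
      _ ≈⟨ ∑-strictlyDecr (suc l) f ⟩
      withoutOne (suc l) f + withOne (suc l) f ≈⟨ +-cong (weight (suc l) (le-≤ {l} ℕₚ.≤-refl) (ℕₚ.n∸n≡0 l)) (weight l (le-≤ (ℕₚ.n≤1+n l)) (ℕₚ.m+n∸n≡m 1 l)) ⟩
      _ ≈⟨ ∑-uˡ-suc 1# 1# (suc l) l _ ⟨
      _ ∎
      where
      weight : ∀ {c j j′} v → c ≈ 1# → j ≡ j′ → ∑ (rowsFrom (oneTo k) v) (λ row → ⟦ strictlyDecr row ⟧ * f (raise j′ row))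
               ≈ c * (1# * ∑ (rowsFrom (oneTo k) v) (λ row → ⟦ strictlyDecr row ⟧ * f (raise j row)))
      weight v c≈1 ≡.refl = sym (trans (*-congʳ c≈1) (trans (*-identityˡ _) (*-identityˡ _)))

  ∑-strictlyDecr-long : ∀ k l (f : List ℕ → Carrier) → k < l →
    ∑ (rowsFrom (oneTo k) l) (λ row → ⟦ strictlyDecr row ⟧ * f row) ≈ 0#
  ∑-strictlyDecr-long zero    (suc l) f k<l       = refl
  ∑-strictlyDecr-long (suc k) (suc l) f (s≤s k<l) = begin
    _ ≈⟨ ∑-strictlyDecr k (suc l) f ⟩
    _ ≈⟨ +-cong (∑-strictlyDecr-long k (suc l) (f ∘ raise 0) (ℕₚ.m<n⇒m<1+n k<l)) (∑-strictlyDecr-long k l (f ∘ raise 1) k<l) ⟩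
    0# + 0# ≈⟨ +-identityʳ _ ⟩
    0# ∎

  fillings-long : ∀ {k l} prev μ → k < l → fillings k prev (l ∷ μ) ≈ 0#
  fillings-long {k} {l} prev μ k<l = ∑-strictlyDecr-long k l _ k<l

  -- A 1 may stand under anything, but a raised entry is at least 2 and cannot stand under a 1. Only
  -- the raised part of the lower row must therefore fit under the raised part of `prev`, which says
  -- that the lengths left after the deletion form a partition.
  belowLeq-raise : ∀ i row j prev → All (1 ≤_) row → length row ℕ.+ i ≤ length prev ℕ.+ j →
    ⟦ belowLeq (raise i row) (raise j prev) ⟧ ≈ le (length row) (length prev) * ⟦ belowLeq row prev ⟧
  belowLeq-raise i []            j       prev       _        _       = trans (reflexive (≡.cong ⟦_⟧ (ones i j prev))) (sym (*-identityˡ _))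
    where
    ones : ∀ i j prev → belowLeq (replicate i 1) (raise j prev) ≡ true
    ones zero    j       prev       = ≡.refl
    ones (suc i) zero    []         = ≡.refl
    ones (suc i) (suc j) []         = ones i j []
    ones (suc i) j       (a ∷ prev) = ones i j prev
  belowLeq-raise i (zero ∷ row)  j       prev       (() ∷ _) _
  belowLeq-raise i (suc b ∷ row) zero    []         _        ()
  belowLeq-raise i (suc b ∷ row) (suc j) []         _        _       = sym (zeroˡ _)
  belowLeq-raise i (suc b ∷ row) j       (a ∷ prev) (_ ∷ ps) (s≤s p) = begin
    _ ≈⟨ ⟦∧⟧ (suc (suc b) ≤ᵇ suc a) _ ⟩
    _ ≈⟨ *-congˡ (belowLeq-raise i row j prev ps p) ⟩
    _ ≈⟨ *-leftComm _ _ _ ⟩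
    _ ≈⟨ *-congˡ (⟦∧⟧ (suc b ≤ᵇ a) _) ⟨
    _ ∎

  fillings-peel-∷ : ∀ k c m l μ prev prev′ →
    (∀ i row → All (1 ≤_) row → length row ℕ.+ i ≡ l → ⟦ belowLeq (raise i row) prev ⟧ ≈ le (length row) c * ⟦ belowLeq row prev′ ⟧) →
    (∀ i row → length row ℕ.+ i ≡ l →
      fillings k (raise i row) μ ≈ ∑ (parts (length row) m) (λ ν → V 1# 1# ν μ * fillings (ℕ.pred k) row ν)) →
    fillings (suc k) prev (l ∷ μ) ≈ ∑ (parts c (suc m)) (λ ν → V 1# 1# ν (l ∷ μ) * fillings k prev′ ν)
  fillings-peel-∷ k c m l μ prev prev′ column peel = begin
    _ ≈⟨ ∑-strictlyDecr-u k l _ ⟩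
    _ ≈⟨ ∑-congAll (All.map byLength (zeroTo-≤ l)) ⟩
    ∑ (zeroTo l) (λ v → le v c * (u 1# 1# v l * Z v)) ≈⟨ ∑≤-exchange l c _ ⟩
    ∑ (zeroTo c) (λ v → le v l * (u 1# 1# v l * Z v)) ≈⟨ ∑-cong (zeroTo c) absorb ⟩
    ∑ (zeroTo c) (λ v → u 1# 1# v l * Z v) ≈⟨ ∑-cong (zeroTo c) collect ⟨
    _ ≈⟨ ∑P-suc c m _ ⟨
    _ ∎
    where
    w = λ row → ⟦ strictlyDecr row ⟧ * ⟦ belowLeq row prev′ ⟧
    Z = λ v → ∑ (rowsFrom (oneTo k) v) (λ row → w row * ∑ (parts v m) (λ ν → V 1# 1# ν μ * fillings (ℕ.pred k) row ν))
    byLength : ∀ {v} → v ≤ l → u 1# 1# v l * ∑ (rowsFrom (oneTo k) v) (λ row → ⟦ strictlyDecr row ⟧ *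
                 (⟦ belowLeq (raise (l ∸ v) row) prev ⟧ * fillings k (raise (l ∸ v) row) μ)) ≈ le v c * (u 1# 1# v l * Z v)
    byLength {v} v≤l = begin
      _ ≈⟨ *-congˡ (trans (∑-congAll (All.map (λ {row} (ps , e) → byRow row ps e) (rowsFrom-All (oneTo-≥1 k) v))) (∑-*ˡ (rowsFrom (oneTo k) v) _ _)) ⟩
      u 1# 1# v l * (le v c * Z v) ≈⟨ *-leftComm _ _ _ ⟩
      _ ∎
      where
      byRow : ∀ row → All (1 ≤_) row → length row ≡ v →
              ⟦ strictlyDecr row ⟧ * (⟦ belowLeq (raise (l ∸ v) row) prev ⟧ * fillings k (raise (l ∸ v) row) μ)
              ≈ le v c * (w row * ∑ (parts v m) (λ ν → V 1# 1# ν μ * fillings (ℕ.pred k) row ν))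
      byRow row ps ≡.refl = begin
        _ ≈⟨ *-congˡ (*-cong (column (l ∸ v) row ps e) (peel (l ∸ v) row e)) ⟩
        _ ≈⟨ solve 4 (λ a b c d → a :* ((b :* c) :* d) := b :* ((a :* c) :* d)) refl ⟦ strictlyDecr row ⟧ (le v c) ⟦ belowLeq row prev′ ⟧ _ ⟩
        _ ∎
        where e = ℕₚ.m+[n∸m]≡n v≤l
    absorb : ∀ v → le v l * (u 1# 1# v l * Z v) ≈ u 1# 1# v l * Z v
    absorb v with v ℕ.≤? l
    ... | yes v≤l = trans (*-congʳ (le-≤ v≤l)) (*-identityˡ _)
    ... | no v≰l  = trans (*-zero-middle (u-< 1# 1# (ℕₚ.≰⇒> v≰l))) (sym (*-zeroˡ (u-< 1# 1# (ℕₚ.≰⇒> v≰l))))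
    collect : ∀ v → ∑ (parts v m) (λ ν → V 1# 1# (v ∷ ν) (l ∷ μ) * fillings k prev′ (v ∷ ν)) ≈ u 1# 1# v l * Z v
    collect v = begin
      _ ≈⟨ ∑-cong (parts v m) (λ ν → trans (*-assoc _ _ _)
             (*-congˡ (*-congˡ (∑-cong (rowsFrom (oneTo k) v) (λ row → sym (*-assoc _ _ _)))))) ⟩
      _ ≈⟨ ∑-*ˡ (parts v m) _ _ ⟩
      u 1# 1# v l * ∑ (parts v m) (λ ν → V 1# 1# ν μ * ∑ (rowsFrom (oneTo k) v) (λ row → w row * fillings (ℕ.pred k) row ν))
        ≈⟨ *-congˡ (∑-cong (parts v m) (λ ν → sym (∑-*ˡ (rowsFrom (oneTo k) v) _ _))) ⟩
      _ ≈⟨ *-congˡ (∑-swap (parts v m) (rowsFrom (oneTo k) v) _) ⟩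
      _ ≈⟨ *-congˡ (∑-cong (rowsFrom (oneTo k) v) (λ row → trans (∑-cong (parts v m) (λ ν → *-leftComm _ _ _)) (∑-*ˡ (parts v m) _ _))) ⟩
      _ ∎

  -- The bound `m ≤ k` keeps the flag of every row positive. At flag 0 the identity breaks: a row of
  -- length 1 has no filling, while adding one box to an empty row has weight 1.
  fillings-peel-below : ∀ {m μ} k prev j → m ≤ k → Part (length prev ℕ.+ j) m μ →
    fillings k (raise j prev) μ ≈ ∑ (parts (length prev) m) (λ ν → V 1# 1# ν μ * fillings (ℕ.pred k) prev ν)
  fillings-peel-below k prev j _ [] = sym (trans (+-identityʳ _) (*-identityˡ _))
  fillings-peel-below {suc m} {l ∷ μ} (suc k) prev j (s≤s m≤k) (l≤p ∷ p) = fillings-peel-∷ k (length prev) m l μ (raise j prev) prev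
    (λ { i row ps ≡.refl → belowLeq-raise i row j prev ps l≤p })
    (λ { i row ≡.refl → fillings-peel-below k row i m≤k p })

  fillings-peel : ∀ {N m μ} k → m ≤ k → Part N m μ →
    fillings k [] μ ≈ ∑ (parts N m) (λ ν → V 1# 1# ν μ * fillings (ℕ.pred k) [] ν)
  fillings-peel k _ [] = sym (trans (+-identityʳ _) (*-identityˡ _))
  fillings-peel {N} {suc m} {l ∷ μ} (suc k) (s≤s m≤k) (l≤N ∷ p) = fillings-peel-∷ k N m l μ [] []
    (λ { i row _ ≡.refl → trans (reflexive (≡.cong ⟦_⟧ (≡.trans (belowLeq-[] (raise i row)) (≡.sym (belowLeq-[] row)))))
           (sym (trans (*-congʳ (le-≤ (ℕₚ.≤-trans (ℕₚ.m≤m+n (length row) i) l≤N))) (*-identityˡ _))) })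
    (λ { i row ≡.refl → fillings-peel-below k row i m≤k p })

  -- After the deletion the flags of the `suc k` rows are k, ..., 1, 0. The last row of `ν` is thus
  -- empty, and its first row, strictly decreasing with entries at most `k`, has at most `k` boxes.
  fillings-recursion : ∀ {k μ} → Part (suc k) (suc k) μ →
    fillings (suc k) [] μ ≈ ∑ (parts k k) (λ ν → fillings k [] ν * V 1# 1# (ν ∷ʳ 0) μ)
  fillings-recursion {k} {μ} p = begin
    _ ≈⟨ fillings-peel (suc k) ℕₚ.≤-refl p ⟩
    _ ≈⟨ ∑P-∷ʳ0 (suc k) k _ (λ { {ν} v ≡.refl _ → *-zeroʳ (fillings-∷ʳsuc [] ν v) }) ⟩
    _ ≈⟨ ∑-cong (parts (suc k) k) (λ ν → trans (*-comm _ _) (*-congʳ (fillings-∷ʳ0 k [] ν))) ⟩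
    _ ≈⟨ ∑P-restrict k _ (ℕₚ.n≤1+n k) (λ {_} {ν} k<v → *-zeroˡ (fillings-long [] ν k<v)) ⟩
    _ ∎

  -- The dual Pieri rule

  Prod : List A → (A → Carrier) → Carrier
  Prod xs f = prodR R (map f xs)

  Prod-cong : ∀ (xs : List A) {f g : A → Carrier} → (∀ a → f a ≈ g a) → Prod xs f ≈ Prod xs g
  Prod-cong []       e = refl
  Prod-cong (x ∷ xs) e = *-cong (e x) (Prod-cong xs e)

  Prod-const1 : ∀ (xs : List A) → Prod xs (λ _ → 1#) ≈ 1#
  Prod-const1 []       = refl
  Prod-const1 (x ∷ xs) = trans (*-identityˡ _) (Prod-const1 xs)

  Prod-* : ∀ (xs : List A) (f g : A → Carrier) → Prod xs (λ a → f a * g a) ≈ Prod xs f * Prod xs g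
  Prod-* []       f g = sym (*-identityˡ 1#)
  Prod-* (x ∷ xs) f g = trans (*-congˡ (Prod-* xs f g))
    (solve 4 (λ a b c d → (a :* b) :* (c :* d) := (a :* c) :* (b :* d)) refl (f x) (g x) (Prod xs f) (Prod xs g))

  Prod-++ : ∀ (xs ys : List A) (f : A → Carrier) → Prod (xs ++ ys) f ≈ Prod xs f * Prod ys f
  Prod-++ []       ys f = sym (*-identityˡ _)
  Prod-++ (x ∷ xs) ys f = trans (*-congˡ (Prod-++ xs ys f)) (sym (*-assoc _ _ _))

  Prod-map : ∀ (xs : List A) (g : A → B) (f : B → Carrier) → Prod (map g xs) f ≈ Prod xs (f ∘ g)
  Prod-map []       g f = refl
  Prod-map (x ∷ xs) g f = *-congˡ (Prod-map xs g f)

  Prod-concatMap : ∀ (xs : List A) (g : A → List B) (f : B → Carrier) →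
                   Prod (concatMap g xs) f ≈ Prod xs (λ a → Prod (g a) f)
  Prod-concatMap []       g f = refl
  Prod-concatMap (x ∷ xs) g f = trans (Prod-++ (g x) _ f) (*-congˡ (Prod-concatMap xs g f))

  Prod-allFin : ∀ n (f : Fin (suc n) → Carrier) → Prod (allFin (suc n)) f ≈ Prod (allFin n) (f ∘ inject₁) * f (fromℕ n)
  Prod-allFin n f = begin
    _ ≈⟨ reflexive (≡.cong (λ xs → Prod xs f) (allFin-∷ʳ n)) ⟩
    _ ≈⟨ Prod-++ (map inject₁ (allFin n)) _ f ⟩
    _ ≈⟨ *-cong (Prod-map (allFin n) inject₁ f) (*-identityʳ _) ⟩
    _ ∎

  rowAt : ℕ → List ℕ → ℕ
  rowAt i       []      = 0
  rowAt zero    (v ∷ _) = v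
  rowAt (suc i) (_ ∷ μ) = rowAt i μ

  rowAt-∷ʳ : ∀ μ v → rowAt (length μ) (μ ∷ʳ v) ≡ v
  rowAt-∷ʳ []      v = ≡.refl
  rowAt-∷ʳ (_ ∷ μ) v = rowAt-∷ʳ μ v

  H-interlaces : ∀ t c i μ θ → rowAt (suc i) μ ≤ rowAt i θ ⊎ H t 0 c μ θ ≈ 0#
  H-interlaces t c i       []          θ       = inj₁ z≤n
  H-interlaces t c i       (v ∷ μ)     []      = inj₂ refl
  H-interlaces t c zero    (v ∷ [])    (l ∷ θ) = inj₁ z≤n
  H-interlaces t c zero    (v ∷ w ∷ μ) (l ∷ θ) with w ℕ.≤? l
  ... | yes w≤l = inj₁ w≤l
  ... | no w≰l  = inj₂ (*-zeroʳ (*-zeroʳ (H-> t 0 μ θ (ℕₚ.≰⇒> w≰l))))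
  H-interlaces t c (suc i) (v ∷ μ)     (l ∷ θ) with H-interlaces t l i μ θ
  ... | inj₁ i≤  = inj₁ i≤
  ... | inj₂ H≈0 = inj₂ (*-zeroʳ (*-zeroʳ H≈0))

  -- Each branching spends one variable and, by interlacing, moves a nonempty row up by at most one
  -- place. Without variables a nonempty first row would remain, and it has no tableau.
  schur-tooManyRows : ∀ n (x : Fin n → Carrier) {N m θ} → Part N m θ → 1 ≤ rowAt n θ → tableaux x [] θ ≈ 0#
  schur-tooManyRows zero    x {θ = suc l ∷ θ} _ _ = refl
  schur-tooManyRows (suc n) x {N} {m} {θ} p 1≤θ = begin
    _ ≈⟨ schur-branch x p ⟩
    _ ≈⟨ ∑-zeroAll (All.map (λ {κ} q → vanish κ q) (parts-Part N m)) ⟩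
    0# ∎
    where
    vanish : ∀ κ → Part N m κ → H (x (fromℕ n)) 0 N θ κ * tableaux (x ∘ inject₁) [] κ ≈ 0#
    vanish κ q with H-interlaces (x (fromℕ n)) N n θ κ
    ... | inj₁ θ≤κ = *-zeroʳ (schur-tooManyRows n (x ∘ inject₁) q (ℕₚ.≤-trans 1≤θ θ≤κ))
    ... | inj₂ H≈0 = *-zeroˡ H≈0

  schur-∷ʳsuc : ∀ {n} (x : Fin n → Carrier) {N m} μ v → length μ ≡ n → Part N m (μ ∷ʳ suc v) → tableaux x [] (μ ∷ʳ suc v) ≈ 0#
  schur-∷ʳsuc x μ v ≡.refl p = schur-tooManyRows (length μ) x p (≡.subst (1 ≤_) (≡.sym (rowAt-∷ʳ μ (suc v))) (s≤s z≤n))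

  data Snoc (N m : ℕ) : List ℕ → Set where
    snoc : ∀ μ v → length μ ≡ m → Part N m μ → Snoc N m (μ ∷ʳ v)

  Part-snoc : ∀ {N m μ} → Part N (suc m) μ → Snoc N m μ
  Part-snoc {m = zero}  (v≤N ∷ []) = snoc [] _ ≡.refl []
  Part-snoc {m = suc m} (v≤N ∷ p) with Part-snoc p
  ... | snoc μ w e q = snoc (_ ∷ μ) w (≡.cong suc e) (v≤N ∷ q)

  -- Row n + 1 of a tableau in n + 1 letters consists of the last letter only, whence the factor
  -- `h t v 0` with `t` the last variable; `v` survives as the floor for the rows above.
  schur-branch-∷ʳ : ∀ {n} (x : Fin (suc n) → Carrier) {N} ν v → length ν ≡ n → Part N (suc n) (ν ∷ʳ v) →
    tableaux x [] (ν ∷ʳ v) ≈ h (x (fromℕ n)) v 0 * ∑ (parts N n) (λ κ → H (x (fromℕ n)) v N ν κ * tableaux (x ∘ inject₁) [] κ)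
  schur-branch-∷ʳ {n} x {N} ν v ≡.refl p = begin
    _ ≈⟨ schur-branch x p ⟩
    _ ≈⟨ ∑P-∷ʳ0 N n _ (λ {μ} w e q → *-zeroʳ (schur-∷ʳsuc (x ∘ inject₁) μ w e q)) ⟩
    _ ≈⟨ ∑P-cong N n (λ {κ} q → trans (*-cong (H-∷ʳ (x (fromℕ n)) N ν κ v 0 (≡.sym (Part-length q))) (tableaux-∷ʳ0 (x ∘ inject₁) [] κ))
           (solve 3 (λ a b c → (a :* b) :* c := b :* (a :* c)) refl (H (x (fromℕ n)) v N ν κ) (h (x (fromℕ n)) v 0) _)) ⟩
    _ ≈⟨ ∑-*ˡ (parts N n) _ _ ⟩
    _ ∎

  -- Branching off the last variable `t` turns the left side into `VH`. Exchanging the strips leaves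
  -- `(a + b * t) * h t v 0`: the first factor extends the product by one variable, the second is
  -- the last row in the branching of `ν`. The ceiling `suc N` lets the first row grow.
  pieri : ∀ n (x : Fin n → Carrier) a b {N ν} → Part N n ν →
    ∑ (parts (suc N) n) (λ θ → V a b ν θ * tableaux x [] θ) ≈ Prod (allFin n) (λ i → a + b * x i) * tableaux x [] ν
  pieri zero    x a b []      = +-identityʳ _
  pieri (suc n) x a b {N} p with Part-snoc p
  ... | snoc ν v e _ = begin
    _ ≈⟨ ∑P-cong (suc N) (suc n) (λ q → *-congˡ (schur-branch x q)) ⟩
    _ ≈⟨ ∑-composeʳ (parts (suc N) (suc n)) (parts (suc N) (suc n)) _ _ _ ⟩
    ∑ (parts (suc N) (suc n)) (λ κ → VH t a b (suc N) (suc n) (ν ∷ʳ v) κ * S κ)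
      ≈⟨ ∑P-∷ʳ0 (suc N) n _ (λ {μ} w e q → *-zeroʳ (schur-∷ʳsuc x′ μ w e q)) ⟩
    ∑ (parts (suc N) n) (λ κ → VH t a b (suc N) (suc n) (ν ∷ʳ v) (κ ∷ʳ 0) * S (κ ∷ʳ 0))
      ≈⟨ ∑P-cong (suc N) n (λ {κ} q → begin
           _ ≈⟨ *-cong (VH≈HV t a b ν v κ 0 p (Part-∷ʳ0 q) e (Part-length q)) (tableaux-∷ʳ0 x′ [] κ) ⟩
           _ ≈⟨ *-congʳ (*-congˡ (rowSum t a b {v} z≤n)) ⟩
           _ ≈⟨ solve 3 (λ a b c → (a :* b) :* c := b :* (a :* c)) refl (HV t a b v N n ν κ) ((a + b * t) * h t v 0) (S κ) ⟩
           _ ∎) ⟩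
    _ ≈⟨ ∑-*ˡ (parts (suc N) n) _ _ ⟩
    ((a + b * t) * h t v 0) * ∑ (parts (suc N) n) (λ κ → HV t a b v N n ν κ * S κ)
      ≈⟨ *-congˡ (∑-composeʳ (parts N n) (parts (suc N) n) _ _ _) ⟨
    ((a + b * t) * h t v 0) * ∑ (parts N n) (λ μ → H t v N ν μ * ∑ (parts (suc N) n) (λ κ → V a b μ κ * S κ))
      ≈⟨ *-congˡ (∑P-cong N n (λ {μ} q → trans (*-congˡ (pieri n x′ a b q)) (*-leftComm _ _ _))) ⟩
    ((a + b * t) * h t v 0) * ∑ (parts N n) (λ μ → P * (H t v N ν μ * S μ))
      ≈⟨ *-congˡ (∑-*ˡ (parts N n) P _) ⟩
    ((a + b * t) * h t v 0) * (P * ∑ (parts N n) (λ μ → H t v N ν μ * S μ))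
      ≈⟨ solve 4 (λ l h p s → (l :* h) :* (p :* s) := (p :* l) :* (h :* s)) refl (a + b * t) (h t v 0) P _ ⟩
    (P * (a + b * t)) * (h t v 0 * ∑ (parts N n) (λ μ → H t v N ν μ * S μ))
      ≈⟨ *-cong (sym (Prod-allFin n (λ i → a + b * x i))) (sym (schur-branch-∷ʳ x ν v e p)) ⟩
    _ ∎
    where
    x′ = x ∘ inject₁
    t = x (fromℕ n)
    S = tableaux x′ []
    P = Prod (allFin n) (λ i → a + b * x′ i)

  -- The coefficients  fillings k []  under removal of a horizontal strip

  fillings-HV : ∀ t k {θ} → Part (suc k) k θ →
    ∑ (parts k k) (λ ν → fillings k [] ν * HV t 1# 1# 0 k k ν θ) ≈ ∑ (parts k k) (λ ν → fillings k [] ν * V (1# + t) 1# ν θ)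

  -- By the recursion `fillings (suc k)` arises from `fillings k` by a vertical strip of weights (1,
  -- 1). Moved past the horizontal strip, it leaves `u (1# + t) 1# 0 l` in the last row;
  -- `fillings-HV` supplies the weights (1 + t, 1) in the rows above. As `fillings-HV` at `suc k`
  -- rests on this lemma at `k`, the two climb alternately.
  fillings-H : ∀ t k {θ} → Part (suc k) (suc k) θ →
    ∑ (parts (suc k) (suc k)) (λ μ → fillings (suc k) [] μ * H t 0 (suc k) μ θ)
    ≈ ∑ (parts k k) (λ ν → fillings k [] ν * V (1# + t) 1# (ν ∷ʳ 0) θ)
  fillings-H t k p with Part-snoc p
  ... | snoc θ l e q = begin
    _ ≈⟨ ∑P-cong (suc k) (suc k) (λ pμ → *-congʳ (fillings-recursion pμ)) ⟩
    _ ≈⟨ ∑-composeʳ (parts k k) (parts (suc k) (suc k)) _ _ _ ⟨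
    ∑ (parts k k) (λ ν → fillings k [] ν * VH t 1# 1# (suc k) (suc k) (ν ∷ʳ 0) (θ ∷ʳ l))
      ≈⟨ ∑P-cong k k (λ {ν} pν → trans (*-congˡ (VH≈HV t 1# 1# ν 0 θ l (Part-∷ʳ0 pν) p (Part-length pν) e)) (sym (*-assoc _ _ _))) ⟩
    _ ≈⟨ ∑-*ʳ (parts k k) _ _ ⟩
    _ ≈⟨ *-cong (fillings-HV t k q) (weight l) ⟩
    _ ≈⟨ ∑-*ʳ (parts k k) _ _ ⟨
    _ ≈⟨ ∑P-cong k k (λ {ν} pν → trans (*-congˡ (V-∷ʳ (1# + t) 1# ν θ 0 l (≡.trans (Part-length pν) (≡.sym e)))) (sym (*-assoc _ _ _))) ⟨
    _ ∎
    where
    weight : ∀ l → 1# * h t 0 l + 1# * h t 1 l ≈ u (1# + t) 1# 0 l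
    weight zero          = solve 1 (λ t → con 1 :* con 1 :+ con 1 :* (t :* con 1) := con 1 :+ t) refl t
    weight (suc zero)    = solve 0 (con 1 :* con 0 :+ con 1 :* con 1 := con 1) refl
    weight (suc (suc l)) = solve 0 (con 1 :* con 0 :+ con 1 :* con 0 := con 0) refl

  fillings-HV t zero    []  = solve 0 (con 1 :* (con 1 :* con 1 :+ con 0) :+ con 0 := con 1 :* con 1 :+ con 0) refl
  fillings-HV t (suc k) {θ} p = begin
    _ ≈⟨ ∑-composeʳ (parts (suc k) (suc k)) (parts (suc k) (suc k)) _ _ _ ⟩
    _ ≈⟨ ∑P-cong (suc k) (suc k) (λ pκ → *-congʳ (fillings-H t k pκ)) ⟩
    _ ≈⟨ ∑-composeʳ (parts k k) (parts (suc k) (suc k)) _ _ _ ⟨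
    ∑ (parts k k) (λ ν → fillings k [] ν * VV (1# + t) 1# 1# 1# (suc k) (suc k) (ν ∷ʳ 0) θ)
      -- The strip of weights (1, 1) has to act first, directly on `fillings k`, for the recursion
      -- to absorb it into `fillings (suc k)`.
      ≈⟨ ∑P-cong k k (λ pν → *-congˡ (VV-comm (1# + t) 1# 1# 1# (Part-∷ʳ0 pν) p (s≤s (head-≤ (Part-∷ʳ0 pν))))) ⟩
    ∑ (parts k k) (λ ν → fillings k [] ν * VV 1# 1# (1# + t) 1# (suc k) (suc k) (ν ∷ʳ 0) θ)
      ≈⟨ ∑-composeʳ (parts k k) (parts (suc k) (suc k)) _ _ _ ⟩
    _ ≈⟨ ∑P-cong (suc k) (suc k) (λ pκ → *-congʳ (fillings-recursion pκ)) ⟨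
    _ ∎

  -- The products over pairs

  select : Bool → Carrier → Carrier
  select true  z = z
  select false z = 1#

  module _ (rel : ℕ → ℕ → Bool) where

    pairProd : ∀ n → (Fin n → Carrier) → Carrier
    pairProd n x = Prod (allFin n) (λ i → Prod (allFin n) (λ j → select (rel (toℕ i) (toℕ j)) (1# + x i + x j)))

    -- The new factors are written as `a + b * x i` with `a = 1# + t` and `b = 1#`, the form of
    -- `pieri`. The diagonal pair stays behind `select`, so that one lemma serves both products.
    pairProd-suc : ∀ n (x : Fin (suc n) → Carrier) →
      (∀ {i} → i < n → rel i n ≡ true) → (∀ {i} → i < n → rel n i ≡ false) →
      pairProd (suc n) x ≈ pairProd n (x ∘ inject₁) * Prod (allFin n) (λ i → (1# + x (fromℕ n)) + 1# * x (inject₁ i))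
                           * select (rel n n) (1# + x (fromℕ n) + x (fromℕ n))
    pairProd-suc n x below above = begin
      _ ≈⟨ Prod-allFin n _ ⟩
      _ ≈⟨ *-cong (Prod-cong (allFin n) (λ i → Prod-allFin n _)) (Prod-allFin n _) ⟩
      _ ≈⟨ *-cong (Prod-* (allFin n) _ _) (*-cong (trans (Prod-cong (allFin n) last-row) (Prod-const1 (allFin n)))
             (reflexive (≡.cong (λ k → select (rel k k) (1# + t + t)) (Finₚ.toℕ-fromℕ n)))) ⟩
      _ ≈⟨ *-cong (*-cong (Prod-cong (allFin n) (λ i → Prod-cong (allFin n) (λ j → reflexive
             (≡.cong₂ (λ k l → select (rel k l) (1# + x (inject₁ i) + x (inject₁ j))) (Finₚ.toℕ-inject₁ i) (Finₚ.toℕ-inject₁ j)))))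
             (Prod-cong (allFin n) last-column)) (*-identityˡ _) ⟩
      _ ∎
      where
      t = x (fromℕ n)
      last-row : ∀ j → select (rel (toℕ (fromℕ n)) (toℕ (inject₁ j))) (1# + t + x (inject₁ j)) ≈ 1#
      last-row j rewrite Finₚ.toℕ-fromℕ n | Finₚ.toℕ-inject₁ j | above (Finₚ.toℕ<n j) = refl
      last-column : ∀ i → select (rel (toℕ (inject₁ i)) (toℕ (fromℕ n))) (1# + x (inject₁ i) + t) ≈ (1# + t) + 1# * x (inject₁ i)
      last-column i rewrite Finₚ.toℕ-fromℕ n | Finₚ.toℕ-inject₁ i | below (Finₚ.toℕ<n i) =
        solve 2 (λ x t → con 1 :+ x :+ t := (con 1 :+ t) :+ con 1 :* x) refl (x (inject₁ i)) t

  <ᵇ-true : ∀ {m n} → m < n → (m <ᵇ n) ≡ true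
  <ᵇ-true {zero}  {suc n} _         = ≡.refl
  <ᵇ-true {suc m} {suc n} (s≤s m<n) = <ᵇ-true m<n

  <ᵇ-false : ∀ {m n} → n ≤ m → (m <ᵇ n) ≡ false
  <ᵇ-false {m}     {zero}  _         = ≡.refl
  <ᵇ-false {suc m} {suc n} (s≤s n≤m) = <ᵇ-false n≤m

  ≤ᵇ-true : ∀ {m n} → m ≤ n → (m ≤ᵇ n) ≡ true
  ≤ᵇ-true {zero}  _   = ≡.refl
  ≤ᵇ-true {suc m} m<n = <ᵇ-true m<n

  ≤ᵇ-false : ∀ {m n} → n < m → (m ≤ᵇ n) ≡ false
  ≤ᵇ-false {suc m} (s≤s n≤m) = <ᵇ-false n≤m

  pairProd-concat : ∀ (rel : ℕ → ℕ → Bool) n (x : Fin n → Carrier) (w : Fin n × Fin n → Carrier) →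
    (∀ i j → w (i , j) ≈ 1# + x i + x j) →
    Prod (concatMap (λ i → concatMap (λ j → filterᵇ (λ _ → rel (toℕ i) (toℕ j)) ((i , j) ∷ [])) (allFin n)) (allFin n)) w
    ≈ pairProd rel n x
  pairProd-concat rel n x w e = trans (Prod-concatMap (allFin n) _ w)
    (Prod-cong (allFin n) (λ i → trans (Prod-concatMap (allFin n) _ w) (Prod-cong (allFin n) (single i))))
    where
    single : ∀ i j → Prod (filterᵇ (λ _ → rel (toℕ i) (toℕ j)) ((i , j) ∷ [])) w ≈ select (rel (toℕ i) (toℕ j)) (1# + x i + x j)
    single i j with rel (toℕ i) (toℕ j)
    ... | true  = trans (*-identityʳ _) (e i j)
    ... | false = refl

  prodLt-pairProd : ∀ n (x : Fin n → Carrier) → prodLt R x ≈ pairProd _<ᵇ_ n x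
  prodLt-pairProd n x = pairProd-concat _<ᵇ_ n x _ (λ i j → refl)

  prodLe-pairProd : ∀ n (x : Fin n → Carrier) → prodLe R x ≈ pairProd _≤ᵇ_ n x
  prodLe-pairProd n x = pairProd-concat _≤ᵇ_ n x _ (λ i j → refl)

  prodLt-suc : ∀ n (x : Fin (suc n) → Carrier) →
    prodLt R x ≈ Prod (allFin n) (λ i → (1# + x (fromℕ n)) + 1# * x (inject₁ i)) * prodLt R (x ∘ inject₁)
  prodLt-suc n x = begin
    _ ≈⟨ prodLt-pairProd (suc n) x ⟩
    _ ≈⟨ pairProd-suc _<ᵇ_ n x <ᵇ-true (λ i<n → <ᵇ-false (ℕₚ.<⇒≤ i<n)) ⟩
    _ ≈⟨ *-congˡ (reflexive (≡.cong (λ p → select p (1# + x (fromℕ n) + x (fromℕ n))) (<ᵇ-false {n} ℕₚ.≤-refl))) ⟩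
    _ ≈⟨ *-identityʳ _ ⟩
    _ ≈⟨ *-comm _ _ ⟩
    _ ≈⟨ *-congˡ (prodLt-pairProd n (x ∘ inject₁)) ⟨
    _ ∎

  prodLe-prodLt : ∀ n (x : Fin n → Carrier) → prodLe R x ≈ Prod (allFin n) (λ i → 1# + (1# + 1#) * x i) * prodLt R x
  prodLe-prodLt zero    x = sym (*-identityˡ _)
  prodLe-prodLt (suc n) x = begin
    _ ≈⟨ prodLe-pairProd (suc n) x ⟩
    _ ≈⟨ pairProd-suc _≤ᵇ_ n x (λ i<n → ≤ᵇ-true (ℕₚ.<⇒≤ i<n)) ≤ᵇ-false ⟩
    _ ≈⟨ *-cong (*-congʳ (trans (sym (prodLe-pairProd n x′)) (prodLe-prodLt n x′)))
                (reflexive (≡.cong (λ p → select p (1# + t + t)) (≤ᵇ-true {n} ℕₚ.≤-refl))) ⟩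
    _ ≈⟨ solve 4 (λ d p q t → ((d :* p) :* q) :* (con 1 :+ t :+ t) := (d :* (con 1 :+ (con 1 :+ con 1) :* t)) :* (q :* p)) refl
           (Prod (allFin n) (λ i → 1# + (1# + 1#) * x′ i)) (prodLt R x′) (Prod (allFin n) (λ i → (1# + t) + 1# * x′ i)) t ⟩
    _ ≈⟨ *-cong (Prod-allFin n (λ i → 1# + (1# + 1#) * x i)) (prodLt-suc n x) ⟨
    _ ∎
    where
    x′ = x ∘ inject₁
    t = x (fromℕ n)

  -- The first expansion, over partitions in a square

  prodLt-expansion : ∀ k (x : Fin (suc k) → Carrier) → prodLt R x ≈ ∑ (parts k k) (λ μ → fillings k [] μ * tableaux x [] μ)
  prodLt-expansion zero    x = sym (trans (+-identityʳ _) (*-identityʳ _))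
  prodLt-expansion (suc k) x = begin
    _ ≈⟨ prodLt-suc (suc k) x ⟩
    P * prodLt R x′ ≈⟨ *-congˡ (prodLt-expansion k x′) ⟩
    P * ∑ (parts k k) (λ ν → fillings k [] ν * S ν) ≈⟨ ∑-*ˡ (parts k k) P _ ⟨
    ∑ (parts k k) (λ ν → P * (fillings k [] ν * S ν))
      ≈⟨ ∑P-cong k k (λ {ν} p → trans (*-leftComm _ _ _) (*-congˡ (trans (*-congˡ (sym (tableaux-∷ʳ0 x′ [] ν))) (sym (pieri (suc k) x′ (1# + t) 1# (Part-∷ʳ0 p)))))) ⟩
    ∑ (parts k k) (λ ν → fillings k [] ν * ∑ (parts (suc k) (suc k)) (λ θ → V (1# + t) 1# (ν ∷ʳ 0) θ * S θ))
      ≈⟨ ∑-composeʳ (parts k k) (parts (suc k) (suc k)) _ _ _ ⟩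
    _ ≈⟨ ∑P-cong (suc k) (suc k) (λ p → *-congʳ (fillings-H t k p)) ⟨
    _ ≈⟨ ∑-composeʳ (parts (suc k) (suc k)) (parts (suc k) (suc k)) _ _ _ ⟨
    _ ≈⟨ ∑P-cong (suc k) (suc k) (λ p → *-congˡ (schur-branch x p)) ⟨
    _ ∎
    where
    x′ = x ∘ inject₁
    t = x (fromℕ (suc k))
    S = tableaux x′ []
    P = Prod (allFin (suc k)) (λ i → (1# + t) + 1# * x′ i)

  -- Partitions inside a staircase

  inStaircase : ℕ → List ℕ → Carrier
  inStaircase b []      = 1#
  inStaircase b (v ∷ μ) = le v b * inStaircase (b ∸ 1) μ

  -- Range and filter change roles: on the left the staircase bounds are the range and monotonicity
  -- is the filter, on the right the reverse.
  ∑-subStaircase : ∀ m (f : List ℕ → Carrier) → ∑ (subStaircase m) f ≈ ∑ (parts m m) (λ μ → inStaircase m μ * f μ)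
  ∑-subStaircase m f = trans (∑-filter (choices (map zeroTo (staircaseFrom m m))) weaklyDecr f) (top m f)
    where
    below : ∀ m b N (f : List ℕ → Carrier) →
      ∑ (choices (map zeroTo (staircaseFrom m b))) (λ μ → ⟦ weaklyDecr (N ∷ μ) ⟧ * f μ)
      ≈ ∑ (parts N m) (λ μ → inStaircase b μ * f μ)
    below zero    b N f = refl
    below (suc m) b N f = begin
      _ ≈⟨ ∑-concatMap-map (zeroTo b) (λ _ → choices (map zeroTo (staircaseFrom m (b ∸ 1)))) _∷_ _ ⟩
      _ ≈⟨ ∑-cong (zeroTo b) (λ v → trans
             (∑-cong (choices (map zeroTo (staircaseFrom m (b ∸ 1)))) (λ μ →
               trans (*-congʳ (trans (⟦∧⟧ (v ≤ᵇ N) _) (*-congʳ (⟦≤ᵇ⟧ v N)))) (*-assoc _ _ _)))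
             (trans (∑-*ˡ (choices (map zeroTo (staircaseFrom m (b ∸ 1)))) _ _)
                    (*-congˡ (below m (b ∸ 1) v (λ μ → f (v ∷ μ)))))) ⟩
      _ ≈⟨ ∑≤-exchange b N _ ⟩
      _ ≈⟨ ∑-cong (zeroTo N) (λ v → trans (∑-cong (parts v m) (λ μ → *-assoc _ _ _)) (∑-*ˡ (parts v m) _ _)) ⟨
      _ ≈⟨ ∑P-suc N m _ ⟨
      _ ∎
    top : ∀ m (f : List ℕ → Carrier) → ∑ (choices (map zeroTo (staircaseFrom m m))) (λ μ → ⟦ weaklyDecr μ ⟧ * f μ)
          ≈ ∑ (parts m m) (λ μ → inStaircase m μ * f μ)
    top zero    f = refl
    top (suc m) f = begin
      _ ≈⟨ ∑-concatMap-map (zeroTo (suc m)) (λ _ → choices (map zeroTo (staircaseFrom m m))) _∷_ _ ⟩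
      _ ≈⟨ ∑-cong (zeroTo (suc m)) (λ v → below m m v (λ μ → f (v ∷ μ))) ⟩
      _ ≈⟨ ∑≤-bounded (suc m) _ ⟨
      _ ≈⟨ ∑-cong (zeroTo (suc m)) (λ v → trans (∑-cong (parts v m) (λ μ → *-assoc _ _ _)) (∑-*ˡ (parts v m) _ _)) ⟨
      _ ≈⟨ ∑P-suc (suc m) m _ ⟨
      _ ∎

  -- A strictly decreasing row has at most as many boxes as its flag, so the flags alone confine the
  -- shape to the staircase.
  fillings-inStaircase : ∀ k prev μ → inStaircase k μ * fillings k prev μ ≈ fillings k prev μ
  fillings-inStaircase k prev []      = *-identityˡ _
  fillings-inStaircase k prev (l ∷ μ) with l ℕ.≤? k
  ... | no l≰k  = trans (*-zeroʳ l>k) (sym l>k)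
    where l>k = fillings-long prev μ (ℕₚ.≰⇒> l≰k)
  ... | yes l≤k = begin
    _ ≈⟨ *-congʳ (trans (*-congʳ (le-≤ l≤k)) (*-identityˡ _)) ⟩
    _ ≈⟨ ∑-*ˡ (rowsFrom (oneTo k) l) _ _ ⟨
    _ ≈⟨ ∑-cong (rowsFrom (oneTo k) l) (λ row → trans
           (solve 4 (λ s a b c → s :* (a :* (b :* c)) := a :* (b :* (s :* c))) refl (inStaircase (k ∸ 1) μ) ⟦ strictlyDecr row ⟧ ⟦ belowLeq row prev ⟧ _)
           (*-congˡ (*-congˡ (fillings-inStaircase (k ∸ 1) row μ)))) ⟩
    _ ∎

  -- From one staircase to the next each row bound rises by one, which is room for the one box a
  -- vertical strip may add. By `length μ ≤ k` no bound is truncated before the new last row, whose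
  -- bound is thus at least 1.
  V-inStaircase : ∀ a b k μ θ → length μ ≤ k → length θ ≡ suc (length μ) →
    inStaircase (suc k) θ * (inStaircase k μ * V a b (μ ∷ʳ 0) θ) ≈ inStaircase k μ * V a b (μ ∷ʳ 0) θ
  V-inStaircase a b k       []      (zero ∷ [])        _         _ = solve 1 (λ a → (con 1 :* con 1) :* (con 1 :* (a :* con 1)) := con 1 :* (a :* con 1)) refl a
  V-inStaircase a b k       []      (suc zero ∷ [])    _         _ = solve 1 (λ a → (con 1 :* con 1) :* (con 1 :* (a :* con 1)) := con 1 :* (a :* con 1)) refl b
  V-inStaircase a b k       []      (suc (suc l) ∷ []) _         _ = trans (*-zeroʳ (*-zero-middle refl)) (sym (*-zero-middle refl))
  V-inStaircase a b (suc k) (v ∷ μ) (l ∷ θ)            (s≤s μ≤k) e = begin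
    _ ≈⟨ solve 6 (λ x s y r w z → (x :* s) :* ((y :* r) :* (w :* z)) := (x :* (y :* w)) :* (s :* (r :* z))) refl
           (le l (suc (suc k))) (inStaircase (suc k) θ) (le v (suc k)) (inStaircase k μ) (u a b v l) (V a b (μ ∷ʳ 0) θ) ⟩
    _ ≈⟨ *-cong row (V-inStaircase a b k μ θ μ≤k (ℕₚ.suc-injective e)) ⟩
    _ ≈⟨ solve 4 (λ y w r z → (y :* w) :* (r :* z) := (y :* r) :* (w :* z)) refl (le v (suc k)) (u a b v l) (inStaircase k μ) (V a b (μ ∷ʳ 0) θ) ⟩
    _ ∎
    where
    row : le l (suc (suc k)) * (le v (suc k) * u a b v l) ≈ le v (suc k) * u a b v l
    row with v ℕ.≤? suc k | l ℕ.≤? suc (suc k)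
    ... | no v≰  | _      = trans (*-zero-middle (le-> (ℕₚ.≰⇒> v≰))) (sym (*-zeroˡ (le-> (ℕₚ.≰⇒> v≰))))
    ... | yes _  | yes l≤ = trans (*-congʳ (le-≤ l≤)) (*-identityˡ _)
    ... | yes v≤ | no l≰  = trans (*-zeroʳ (*-zeroʳ l≫v)) (sym (*-zeroʳ l≫v))
      where l≫v = u-≫ a b (ℕₚ.≤-<-trans (s≤s v≤) (ℕₚ.≰⇒> l≰))

  -- Vertical strips weighted by powers of two

  natR-+ : ∀ m n → natR R (m ℕ.+ n) ≈ natR R m + natR R n
  natR-+ zero    n = sym (+-identityˡ _)
  natR-+ (suc m) n = trans (+-congˡ (natR-+ m n)) (sym (+-assoc _ _ _))

  natR-2^suc : ∀ e → natR R (2 ℕ.^ suc e) ≈ (1# + 1#) * natR R (2 ℕ.^ e)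
  natR-2^suc e = begin
    _ ≈⟨ natR-+ (2 ℕ.^ e) _ ⟩
    _ ≈⟨ +-congˡ (natR-+ (2 ℕ.^ e) 0) ⟩
    _ ≈⟨ solve 1 (λ x → x :+ (x :+ con 0) := (con 1 :+ con 1) :* x) refl (natR R (2 ℕ.^ e)) ⟩
    _ ∎

  isStrip : List ℕ → List ℕ → Bool
  isStrip μ θ = containedᵇ μ θ ∧ verticalStripᵇ μ θ

  -- `skewSize` subtracts total sizes while `V` multiplies row by row. The view carries the exponent
  -- `e` additively through the rows, and the truncated subtraction is evaluated once at the end.
  data StripView (μ θ : List ℕ) : Set ℓ where
    strip    : ∀ e → isStrip μ θ ≡ true → sum θ ≡ sum μ ℕ.+ e →
               V 1# (1# + 1#) (μ ∷ʳ 0) θ ≈ natR R (2 ℕ.^ e) → StripView μ θ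
    notStrip : isStrip μ θ ≡ false → V 1# (1# + 1#) (μ ∷ʳ 0) θ ≈ 0# → StripView μ θ

  isStrip-∷ : ∀ {v l} μ θ → v ≤ l → l ≤ suc v → isStrip (v ∷ μ) (l ∷ θ) ≡ isStrip μ θ
  isStrip-∷ μ θ v≤l l≤1+v = ≡.cong₂ (λ p q → (p ∧ containedᵇ μ θ) ∧ (q ∧ verticalStripᵇ μ θ)) (≤ᵇ-true v≤l) (≤ᵇ-true l≤1+v)

  stripView-≡ : ∀ v {μ θ} → StripView μ θ → StripView (v ∷ μ) (v ∷ θ)
  stripView-≡ v {μ} {θ} (strip k p s w) = strip k (≡.trans (isStrip-∷ μ θ ℕₚ.≤-refl (ℕₚ.n≤1+n v)) p)
    (≡.trans (≡.cong (v ℕ.+_) s) (≡.sym (ℕₚ.+-assoc v (sum μ) k)))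
    (trans (*-cong (u-diag 1# (1# + 1#) v) w) (*-identityˡ _))
  stripView-≡ v {μ} {θ} (notStrip p w) = notStrip (≡.trans (isStrip-∷ μ θ ℕₚ.≤-refl (ℕₚ.n≤1+n v)) p) (*-zeroʳ w)

  stripView-suc : ∀ v {μ θ} → StripView μ θ → StripView (v ∷ μ) (suc v ∷ θ)
  stripView-suc v {μ} {θ} (strip k p s w) = strip (suc k) (≡.trans (isStrip-∷ μ θ (ℕₚ.n≤1+n v) ℕₚ.≤-refl) p)
    (≡.trans (≡.cong (suc v ℕ.+_) s) (≡.trans (≡.cong suc (≡.sym (ℕₚ.+-assoc v (sum μ) k))) (≡.sym (ℕₚ.+-suc (v ℕ.+ sum μ) k))))
    (trans (*-cong (u-suc 1# (1# + 1#) v) w) (sym (natR-2^suc k)))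
  stripView-suc v {μ} {θ} (notStrip p w) = notStrip (≡.trans (isStrip-∷ μ θ (ℕₚ.n≤1+n v) ℕₚ.≤-refl) p) (*-zeroʳ w)

  stripView : ∀ μ θ → length θ ≡ suc (length μ) → StripView μ θ
  stripView [] (zero ∷ [])        _ = strip 0 ≡.refl ≡.refl (solve 0 (con 1 :* con 1 := con 1 :+ con 0) refl)
  stripView [] (suc zero ∷ [])    _ = strip 1 ≡.refl ≡.refl (solve 0 ((con 1 :+ con 1) :* con 1 := con 1 :+ (con 1 :+ con 0)) refl)
  stripView [] (suc (suc l) ∷ []) _ = notStrip ≡.refl (zeroˡ _)
  stripView (v ∷ μ) (l ∷ θ) e with ℕₚ.<-cmp l v
  ... | tri< l<v _ _ = notStrip (≡.cong (λ p → (p ∧ containedᵇ μ θ) ∧ verticalStripᵇ (v ∷ μ) (l ∷ θ)) (≤ᵇ-false l<v)) (*-zeroˡ (u-< 1# (1# + 1#) l<v))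
  ... | tri≈ _ ≡.refl _ = stripView-≡ v (stripView μ θ (ℕₚ.suc-injective e))
  ... | tri> _ _ v<l with ℕₚ.<-cmp l (suc v)
  ...   | tri< l<1+v _ _ = contradiction v<l (ℕₚ.≤⇒≯ (ℕₚ.≤-pred l<1+v))
  ...   | tri≈ _ ≡.refl _ = stripView-suc v (stripView μ θ (ℕₚ.suc-injective e))
  ...   | tri> _ _ 1+v<l = notStrip
    (≡.trans (≡.cong (λ q → containedᵇ (v ∷ μ) (l ∷ θ) ∧ (q ∧ verticalStripᵇ μ θ)) (≤ᵇ-false 1+v<l)) (Boolₚ.∧-zeroʳ (containedᵇ (v ∷ μ) (l ∷ θ))))
    (*-zeroˡ (u-≫ 1# (1# + 1#) 1+v<l))

  strip-weight : ∀ μ θ → length θ ≡ suc (length μ) → ⟦ isStrip μ θ ⟧ * natR R (2 ℕ.^ skewSize θ μ) ≈ V 1# (1# + 1#) (μ ∷ʳ 0) θ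
  strip-weight μ θ e with stripView μ θ e
  ... | notStrip p w  = trans (*-zeroˡ (reflexive (≡.cong ⟦_⟧ p))) (sym w)
  ... | strip k p s w = begin
    _ ≈⟨ *-cong (reflexive (≡.cong ⟦_⟧ p)) (reflexive (≡.cong (λ d → natR R (2 ℕ.^ d)) (≡.trans (≡.cong (_∸ sum μ) s) (ℕₚ.m+n∸m≡n (sum μ) k)))) ⟩
    _ ≈⟨ *-identityˡ _ ⟩
    _ ≈⟨ w ⟨
    _ ∎

  -- The stated right-hand sides and the second expansion

  rhsLt-parts : ∀ k (x : Fin (suc k) → Carrier) → rhsLt R x ≈ ∑ (parts k k) (λ μ → fillings k [] μ * tableaux x [] μ)
  rhsLt-parts k x = begin
    _ ≈⟨ ∑-subStaircase k _ ⟩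
    _ ≈⟨ ∑-cong (parts k k) (λ μ → begin
           _ ≈⟨ *-congˡ (*-cong (r-fillings (suc k) μ) (schur-tableaux x μ)) ⟩
           _ ≈⟨ *-assoc _ _ _ ⟨
           _ ≈⟨ *-congʳ (fillings-inStaircase k [] μ) ⟩
           _ ∎) ⟩
    _ ∎

  rhsLe-parts : ∀ k (x : Fin (suc k) → Carrier) → rhsLe R x ≈
    ∑ (parts (suc k) (suc k)) (λ θ → ∑ (parts k k) (λ μ → fillings k [] μ * V 1# (1# + 1#) (μ ∷ʳ 0) θ) * tableaux x [] θ)
  rhsLe-parts k x = begin
    _ ≈⟨ ∑-subStaircase (suc k) _ ⟩
    _ ≈⟨ ∑P-cong (suc k) (suc k) (λ {θ} p → begin
           _ ≈⟨ *-congˡ (trans (∑-filter (subStaircase k) _ _) (∑-subStaircase k _)) ⟩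
           _ ≈⟨ ∑-*ˡ (parts k k) _ _ ⟨
           _ ≈⟨ ∑P-cong k k (λ {μ} q → term μ θ (Part-length q) (Part-length p)) ⟩
           _ ≈⟨ ∑-*ʳ (parts k k) _ _ ⟩
           _ ∎) ⟩
    _ ∎
    where
    term : ∀ μ θ → length μ ≡ k → length θ ≡ suc k →
      inStaircase (suc k) θ * (inStaircase k μ * (⟦ isStrip μ θ ⟧ * (natR R (2 ℕ.^ skewSize θ μ) * natR R (r (suc k) μ) * schur R x θ)))
      ≈ fillings k [] μ * V 1# (1# + 1#) (μ ∷ʳ 0) θ * tableaux x [] θ
    term μ θ ≡.refl eθ = begin
      _ ≈⟨ *-congˡ (*-congˡ (*-congˡ (*-cong (*-congˡ (r-fillings (suc k) μ)) (schur-tableaux x θ)))) ⟩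
      _ ≈⟨ solve 6 (λ a b c d e f → a :* (b :* (c :* ((d :* e) :* f))) := (e :* (a :* (b :* (c :* d)))) :* f) refl
             (inStaircase (suc k) θ) (inStaircase k μ) ⟦ isStrip μ θ ⟧ (natR R (2 ℕ.^ skewSize θ μ)) (fillings k [] μ) (tableaux x [] θ) ⟩
      _ ≈⟨ *-congʳ (*-congˡ (*-congˡ (*-congˡ (strip-weight μ θ eθ)))) ⟩
      -- The indicator of `θ` goes first, while that of `μ` is still there to bound `θ`; the latter
      -- is then absorbed by `fillings`.
      _ ≈⟨ *-congʳ (*-congˡ (V-inStaircase 1# (1# + 1#) k μ θ ℕₚ.≤-refl eθ)) ⟩
      _ ≈⟨ *-congʳ (solve 3 (λ a b c → a :* (b :* c) := (b :* a) :* c) refl (fillings k [] μ) (inStaircase k μ) _) ⟩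
      _ ≈⟨ *-congʳ (*-congʳ (fillings-inStaircase k [] μ)) ⟩
      _ ∎

  prodLe-expansion : ∀ k (x : Fin (suc k) → Carrier) → prodLe R x ≈ rhsLe R x
  prodLe-expansion k x = begin
    _ ≈⟨ prodLe-prodLt (suc k) x ⟩
    P * prodLt R x ≈⟨ *-congˡ (prodLt-expansion k x) ⟩
    P * ∑ (parts k k) (λ μ → fillings k [] μ * S μ) ≈⟨ ∑-*ˡ (parts k k) P _ ⟨
    ∑ (parts k k) (λ μ → P * (fillings k [] μ * S μ))
      ≈⟨ ∑P-cong k k (λ {μ} p → trans (*-leftComm _ _ _) (*-congˡ (trans (*-congˡ (sym (tableaux-∷ʳ0 x [] μ))) (sym (pieri (suc k) x 1# (1# + 1#) (Part-∷ʳ0 p)))))) ⟩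
    ∑ (parts k k) (λ μ → fillings k [] μ * ∑ (parts (suc k) (suc k)) (λ θ → V 1# (1# + 1#) (μ ∷ʳ 0) θ * S θ))
      ≈⟨ ∑-composeʳ (parts k k) (parts (suc k) (suc k)) _ _ _ ⟩
    _ ≈⟨ rhsLe-parts k x ⟨
    _ ∎
    where
    S = tableaux x []
    P = Prod (allFin (suc k)) (λ i → 1# + (1# + 1#) * x i)

theorem4p2 : ∀ {c ℓ} (R : CommutativeRing c ℓ) (n : ℕ) → n ≥ 1 →
    (x : Fin n → CommutativeRing.Carrier R) →
    CommutativeRing._≈_ R (prodLt R x) (rhsLt R x)
    × CommutativeRing._≈_ R (prodLe R x) (rhsLe R x)
theorem4p2 R (suc k) _ x = trans (prodLt-expansion k x) (sym (rhsLt-parts k x)) , prodLe-expansion k x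
  where
  open CommutativeRing R using (trans; sym)
  open Expansion R
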